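{- The randomized algorithm $\mathrm{RandHeavyTest}_{0.5}$ for online graph exploration on cycles has competitive ratio at most $1+\frac{(3-\sqrt{2})^2}{8}\approx 1.314$.
   Context: **Online exploration of cycles.** The input is a cycle $\Gamma$ (a cycle graph on $n\ge 3$ vertices) with non-negative edge weights $w$, together with a starting vertex $s$. An agent starts at $s$ and initially has no knowledge of the graph other than that it is a cycle. Whenever it visits a vertex for the first time (including $s$ at the start), it learns the identifiers of the adjacent vertices and the weights of the incident edges. The agent repeatedly decides which known edge to traverse next; traversing an edge costs its weight. The agent must visit all vertices and return to $s$. Let $\mathrm{Alg}(\Gamma,s)$ be the total cost of an algorithm $\mathrm{Alg}$ (a random variable if $\mathrm{Alg}$ is randomized), and let $\mathrm{Opt}(\Gamma)$ be the minimum length of a closed walk in $\Gamma$ visiting every vertex. A randomized algorithm $\mathrm{Alg}$ is $\rho$-competitive (on cycles, against an oblivious adversary) if $\mathbb{E}[\mathrm{Alg}(\Gamma,s)]\le \rho\cdot \mathrm{Opt}(\Gamma)$ for every fixed weighted cycle $\Gamma$ and every starting vertex $s$. The competitive ratio of $\mathrm{Alg}$ is the infimum of all such $\rho$. **Exploration steps.** A boundary edge is an edge with one explored (i.e. visited) and one unexplored endpoint. In each step the agent chooses a boundary edge, travels through the explored part (a path) to its explored endpoint, and traverses it. The explored part is a path until everything is visited, so there are exactly two boundary edges, one at each end; after each step the agent is at the explored endpoint of one of them, called the direct boundary edge; the other one is called the backtracking boundary edge. The agent "moves directly" if it chooses the direct boundary edge and "backtracks" otherwise. While the agent is at $v$ after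 at least one step and not all vertices are visited, let $b$ be the weight of the direct boundary edge, let $a$ be the length of the explored path from $v$ to $s$, and let $d$ be the length of the path from $s$, through the explored part on the other side, to the unexplored endpoint of the backtracking boundary edge (including that edge's weight). Thus a direct move costs $b$ and backtracking costs $a+d$. (If the two boundary edges share their unexplored endpoint, the algorithm does not use this information.) **$\mathrm{RandHeavyTest}_\alpha$** ($\alpha>0$). The first edge traversed is the lighter of the two edges incident to $s$ (ties broken arbitrarily but deterministically). From the second step until all vertices are visited, the agent (using fresh independent randomness in each step) moves directly with probability $$p_{\mathrm{dir}}(a,b,d)=\begin{cases}1 & \text{if } b\le(\alpha+1)a+d,\\ \frac{a}{b-d-a}\cdot\alpha & \text{if } b>(\alpha+1)a+d,\end{cases}$$ and backtracks otherwise. Once the last vertex has been visited, the agent returns to $s$ via a shortest path. -}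

module Defs where

open import Level using (Level; suc; _⊔_)
open import Algebra.Bundles using (CommutativeRing; Semiring)
open import Algebra.Core using (Op₁; Op₂)
open import Algebra.Structures using (IsCommutativeRing)
open import Data.Bool.Base using (true; false)
open import Data.Fin.Base using (Fin; toℕ)
open import Data.List.Base using (List; []; _∷_)
open import Data.List.Membership.Propositional using (_∈_)
open import Data.Nat.Base as ℕ using (ℕ; zero)
open import Data.Nat.DivMod using (_mod_)
open import Data.Product.Base using (Σ-syntax; _×_)
open import Relation.Binary.Bundles using (TotalOrder)
open import Relation.Binary.Core using (Rel)
open import Relation.Binary.Structures using (IsDecTotalOrder)
open import Relation.Nullary.Decidable.Core using (does)
open import Relation.Nullary.Negation.Core using (¬_)
import Algebra.Construct.NaturalChoice.Min as Min
import Algebra.Definitions.RawSemiring as RawSemiringDefs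

-- The standard library has no real numbers. Weights, probabilities and costs
-- are taken in an arbitrary linearly ordered field with decidable order; the
-- classical real field is one instance. The inverse is total, with an
-- unspecified value at 0.
record OrderedField (c ℓ₁ ℓ₂ : Level) : Set (suc (c ⊔ ℓ₁ ⊔ ℓ₂)) where
  infix  8 _⁻¹
  infix  8 -_
  infixl 7 _*_ _/_
  infixl 6 _+_ _-_
  infix  4 _≈_ _≤_
  field
    Carrier           : Set c
    _≈_               : Rel Carrier ℓ₁
    _≤_               : Rel Carrier ℓ₂
    _+_ _*_           : Op₂ Carrier
    -_ _⁻¹            : Op₁ Carrier
    0# 1#             : Carrier
    isCommutativeRing : IsCommutativeRing _≈_ _+_ _*_ -_ 0# 1#
    isDecTotalOrder   : IsDecTotalOrder _≈_ _≤_
    0≉1               : ¬ (0# ≈ 1#)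
    ⁻¹-cong           : ∀ {x y} → x ≈ y → x ⁻¹ ≈ y ⁻¹
    ⁻¹-inverseʳ       : ∀ x → ¬ (x ≈ 0#) → x * x ⁻¹ ≈ 1#
    +-monoˡ-≤         : ∀ z {x y} → x ≤ y → x + z ≤ y + z
    *-nonNeg          : ∀ {x y} → 0# ≤ x → 0# ≤ y → 0# ≤ x * y

  open IsDecTotalOrder isDecTotalOrder public
    using (_≤?_; isTotalOrder)

  commutativeRing : CommutativeRing c ℓ₁
  commutativeRing = record { isCommutativeRing = isCommutativeRing }

  totalOrder : TotalOrder c ℓ₁ ℓ₂
  totalOrder = record { isTotalOrder = isTotalOrder }

  open RawSemiringDefs
    (Semiring.rawSemiring (CommutativeRing.semiring commutativeRing)) public
    using (_^_) renaming (_×_ to _·_)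
  open Min totalOrder public using (_⊓_)

  _-_ : Op₂ Carrier
  x - y = x + (- y)

  _/_ : Op₂ Carrier
  x / y = x * y ⁻¹

  fromℕ : ℕ → Carrier
  fromℕ k = k · 1#

  IsInfimum : ∀ {p} → (Carrier → Set p) → Carrier → Set (c ⊔ ℓ₂ ⊔ p)
  IsInfimum P r = (∀ x → P x → r ≤ x)
                × (∀ b → (∀ x → P x → b ≤ x) → b ≤ r)

data Direction : Set where
  cw ccw : Direction

opposite : Direction → Direction
opposite cw  = ccw
opposite ccw = cw

module Exploration {c ℓ₁ ℓ₂} (F : OrderedField c ℓ₁ ℓ₂) where
  open OrderedField F

  -- The cycle has n = 3 + extra vertices 0, …, n - 1; edge i joins i and
  -- i + 1 (mod n) and has weight w i.
  record WeightedCycle : Set (c ⊔ ℓ₂) where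
    field
      extra    : ℕ
    n : ℕ
    n = 3 ℕ.+ extra
    field
      w        : Fin n → Carrier
      w-nonNeg : ∀ i → 0# ≤ w i

    Vertex : Set
    Vertex = Fin n

    step : Direction → Vertex → Vertex
    step cw  v = (toℕ v ℕ.+ 1) mod n
    step ccw v = (toℕ v ℕ.+ (2 ℕ.+ extra)) mod n

    steps : Direction → ℕ → Vertex → Vertex
    steps δ zero      v = v
    steps δ (ℕ.suc k) v = steps δ k (step δ v)

    -- weight of the edge joining v and step δ v
    weight : Direction → Vertex → Carrier
    weight cw  v = w v
    weight ccw v = w (step ccw v)

    -- length of the path that leaves v in direction δ and has k edges
    arc : Direction → Vertex → ℕ → Carrier
    arc δ v zero      = 0#
    arc δ v (ℕ.suc k) = weight δ v + arc δ (step δ v) k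

    data Walk : Vertex → Vertex → Set where
      stop : ∀ {v} → Walk v v
      move : ∀ {u v} (δ : Direction) → Walk (step δ u) v → Walk u v

    length : ∀ {u v} → Walk u v → Carrier
    length stop                 = 0#
    length (move {u = u} δ rest) = weight δ u + length rest

    visited : ∀ {u v} → Walk u v → List Vertex
    visited {u} stop          = u ∷ []
    visited {u} (move δ rest) = u ∷ visited rest

    record Tour : Set where
      field
        base      : Vertex
        walk      : Walk base base
        visitsAll : ∀ x → x ∈ visited walk

    tourLength : Tour → Carrier
    tourLength t = length (Tour.walk t)

    IsOpt : Carrier → Set (ℓ₁ ⊔ ℓ₂)
    IsOpt o = (Σ[ t ∈ Tour ] tourLength t ≈ o)
            × (∀ t → o ≤ tourLength t)

  open WeightedCycle using (Vertex)

  -- A random value produced by finitely many independent biased coin flips: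
  -- coin p x y continues as x with probability p and as y with probability 1 - p.
  data Random {a} (A : Set a) : Set (a ⊔ c) where
    return : A → Random A
    coin   : Carrier → Random A → Random A → Random A

  -- the random cost obtained by paying x first
  pay : Carrier → Random Carrier → Random Carrier
  pay x (return y)   = return (x + y)
  pay x (coin p r t) = coin p (pay x r) (pay x t)

  𝔼 : Random Carrier → Carrier
  𝔼 (return x)   = x
  𝔼 (coin p r t) = p * 𝔼 r + (1# - p) * 𝔼 t

  -- A randomised algorithm, through its total cost on each input.
  Algorithm : Set (c ⊔ ℓ₂)
  Algorithm = (Γ : WeightedCycle) (s : Vertex Γ) → Random Carrier

  Competitive : Algorithm → Carrier → Set (c ⊔ ℓ₁ ⊔ ℓ₂)
  Competitive Alg ρ =
    ∀ Γ s o → WeightedCycle.IsOpt Γ o → 𝔼 (Alg Γ s) ≤ ρ * o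

  IsCompetitiveRatio : Algorithm → Carrier → Set (c ⊔ ℓ₁ ⊔ ℓ₂)
  IsCompetitiveRatio Alg = IsInfimum (Competitive Alg)

  -- An arbitrary rule choosing the first edge when both edges at s have equal
  -- weight. It may depend on the whole input, which covers in particular every
  -- rule based on the identifiers seen at s.
  TieBreaking : Set (c ⊔ ℓ₂)
  TieBreaking = (Γ : WeightedCycle) → Vertex Γ → Direction

  -- In the second case b - d - a > α * a, so for α > 0 and a ≥ 0 the divisor
  -- is positive and the value lies in [0, 1].
  p-dir : (α a b d : Carrier) → Carrier
  p-dir α a b d with does (b ≤? (α + 1#) * a + d)
  ... | true  = 1#
  ... | false = a / (b - d - a) * α

  module _ (α : Carrier) (tie : TieBreaking) (Γ : WeightedCycle) (s : Vertex Γ) where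
    open WeightedCycle Γ using (n; steps; weight; arc)

    firstDirection : Direction
    firstDirection
      with does (weight cw s ≤? weight ccw s) | does (weight ccw s ≤? weight cw s)
    ... | true  | true  = tie Γ s
    ... | true  | false = cw
    ... | false | _     = ccw

    -- explore u δ k m is the cost still to be paid when u vertices are
    -- unexplored, the explored path extends k edges from s in direction δ and
    -- m edges in the opposite direction, and the agent is at its end in
    -- direction δ. In the cycle there are exactly two paths from there back to
    -- s, with k and n ∸ k edges.
    explore : (u : ℕ) (δ : Direction) (k m : ℕ) → Random Carrier
    explore zero δ k m =
      return (arc δ s k ⊓ arc (opposite δ) s (n ℕ.∸ k))
    explore (ℕ.suc u) δ k m =
      coin (p-dir α a b d)
        (pay b       (explore u δ (ℕ.suc k) m))
        (pay (a + d) (explore u (opposite δ) (ℕ.suc m) k))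
      where
      a b d : Carrier
      a = arc δ s k
      b = weight δ (steps δ k s)
      d = arc (opposite δ) s (ℕ.suc m)

    randHeavyTestCost : Random Carrier
    randHeavyTestCost =
      pay (weight firstDirection s) (explore (n ℕ.∸ 2) firstDirection 1 0)

  RandHeavyTest : Carrier → TieBreaking → Algorithm
  RandHeavyTest α tie Γ s = randHeavyTestCost α tie Γ s

-- Let L be the total weight. A tour costs at least L, or at least 2(L - w e) for
-- an edge e that it does not use. Hence it suffices to show that the expected
-- cost is at most (2 + κ) r with κ = (3 - √2)² / 4, where r = L / 2 if no edge is
-- heavier than L / 2, and r = L - h if there is such an edge, of weight h.
--
-- In a state (a , b , d) in which backtracking is still possible and the heavy
-- edge, if there is one, is neither explored nor the backtracking edge, the
-- expected remaining cost is at most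
--   2r - a + κ (r - d) - μ a,   μ = κ - 1/2.
-- For a random move with t = b - d - a, the decrease of this bound, multiplied by
-- t, is at least κ t² - (7/4 - κ) a t + a² / 2. The value of κ is chosen so that
-- this is a perfect square. After the heavy edge has been seen, or once half of
-- the cycle is known, the algorithm no longer backtracks and its cost is explicit.
module Submission where

open import Defs
open import Level using (_⊔_)
open import Algebra.Bundles using (CommutativeRing; Semiring)
import Algebra.Construct.NaturalChoice.Min as Min
import Algebra.Definitions.RawSemiring as RawSemiringDefs
import Algebra.Properties.AbelianGroup as AbelianGroupProperties
import Algebra.Properties.Ring as RingProperties
import Algebra.Properties.Semiring.Mult.TCOptimised as MultProperties
import Algebra.Solver.Ring as RingSolver
open import Algebra.Solver.Ring.AlmostCommutativeRing
  using (fromCommutativeRing; _-Raw-AlmostCommutative⟶_)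
open import Data.Fin.Base using (zero; toℕ)
open import Data.Fin.Properties
  using (toℕ-fromℕ<; toℕ-injective; toℕ<n; toℕ≤n; all?; ¬∀⟶∃¬)
  renaming (_≟_ to _≟ᶠ_)
open import Data.Integer.Base as ℤ using (ℤ; +_; -[1+_])
import Data.Integer.Properties as ℤₚ
open import Data.List.Base using (List; []; _∷_)
import Data.List.Membership.DecPropositional as DecMembership
open import Data.List.Membership.Propositional using (_∈_; _∉_)
open import Data.List.Relation.Unary.Any using (here; there; _─_)
import Data.Maybe.Base as Maybe
open import Data.Nat.Base as ℕ using (ℕ; zero; suc; s≤s; z≤n)
open import Data.Nat.DivMod
  using (_%_; _mod_; %-distribˡ-+; m%n%n≡m%n; m%n<n; m<n⇒m%n≡m; [m+n]%n≡m%n)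
import Data.Nat.Properties as ℕₚ
open import Data.Product.Base using (_×_; _,_; proj₁; proj₂; ∃-syntax)
import Data.Sign.Base as Sign
open import Data.Sum.Base using (_⊎_; inj₁; inj₂; [_,_]′)
open import Function.Base using (_∘_)
open import Relation.Binary.PropositionalEquality as ≡ using (_≡_; _≢_)
import Relation.Binary.Reasoning.Setoid as SetoidReasoning
open import Relation.Binary.Structures using (IsDecTotalOrder)
open import Relation.Nullary.Decidable using (yes; no; dec⇒maybe)
open import Relation.Nullary.Negation using (¬_; contradiction)

-- Ring solving with integer coefficients.

-- Any commutative ring is a ℤ-algebra, and ℤ has decidable equality, so the
-- ring solver can cancel terms over an abstract carrier.
module IntegerCoefficientSolver {c ℓ} (R : CommutativeRing c ℓ) where
  open CommutativeRing R
  open RingProperties ring using (-‿distribˡ-*; -‿distribʳ-*; -‿involutive; -0#≈0#)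
  open AbelianGroupProperties +-abelianGroup using () renaming (⁻¹-∙-comm to -‿+-comm)
  open MultProperties semiring using (1+×; ×ᵤ≈×; ×-homo-+; ×1-homo-*) renaming (_×_ to _·_)
  open RawSemiringDefs (Semiring.rawSemiring semiring) using () renaming (_×_ to _×ᵤ_)
  open SetoidReasoning setoid

  ⟦_⟧ : ℤ → Carrier
  ⟦ + n ⟧      = n · 1#
  ⟦ -[1+ n ] ⟧ = - (suc n · 1#)

  ⟦+⟧ : ∀ n → n ×ᵤ 1# ≈ ⟦ + n ⟧
  ⟦+⟧ n = ×ᵤ≈× n 1#

  ⟦⟧-⊖ : ∀ m n → ⟦ m ℤ.⊖ n ⟧ ≈ m · 1# + - (n · 1#)
  ⟦⟧-⊖ m       zero    = sym (trans (+-congˡ -0#≈0#) (+-identityʳ _))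
  ⟦⟧-⊖ zero    (suc n) = sym (+-identityˡ _)
  ⟦⟧-⊖ (suc m) (suc n) = begin
    ⟦ suc m ℤ.⊖ suc n ⟧                       ≡⟨ ≡.cong ⟦_⟧ (ℤₚ.[1+m]⊖[1+n]≡m⊖n m n) ⟩
    ⟦ m ℤ.⊖ n ⟧                               ≈⟨ ⟦⟧-⊖ m n ⟩
    m · 1# + - (n · 1#)                       ≈⟨ +-congʳ (+-identityˡ _) ⟨
    0# + m · 1# + - (n · 1#)                  ≈⟨ +-congʳ (+-congʳ (-‿inverseʳ 1#)) ⟨
    1# + - 1# + m · 1# + - (n · 1#)           ≈⟨ +-congʳ (trans (+-assoc _ _ _) (trans (+-congˡ (+-comm _ _)) (sym (+-assoc _ _ _)))) ⟩
    1# + m · 1# + - 1# + - (n · 1#)           ≈⟨ +-assoc _ _ _ ⟩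
    1# + m · 1# + (- 1# + - (n · 1#))         ≈⟨ +-congˡ (-‿+-comm 1# (n · 1#)) ⟩
    1# + m · 1# + - (1# + n · 1#)             ≈⟨ +-cong (1+× m 1#) (-‿cong (1+× n 1#)) ⟨
    suc m · 1# + - (suc n · 1#)               ∎

  ⟦⟧-+◃ : ∀ n → ⟦ Sign.+ ℤ.◃ n ⟧ ≈ n · 1#
  ⟦⟧-+◃ zero    = refl
  ⟦⟧-+◃ (suc n) = refl

  ⟦⟧--◃ : ∀ n → ⟦ Sign.- ℤ.◃ n ⟧ ≈ - (n · 1#)
  ⟦⟧--◃ zero    = sym -0#≈0#
  ⟦⟧--◃ (suc n) = refl

  ⟦⟧-+ : ∀ i j → ⟦ i ℤ.+ j ⟧ ≈ ⟦ i ⟧ + ⟦ j ⟧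
  ⟦⟧-+ (+ m)    (+ n)    = ×-homo-+ 1# m n
  ⟦⟧-+ (+ m)    -[1+ n ] = ⟦⟧-⊖ m (suc n)
  ⟦⟧-+ -[1+ m ] (+ n)    = trans (⟦⟧-⊖ n (suc m)) (+-comm _ _)
  ⟦⟧-+ -[1+ m ] -[1+ n ] = begin
    - (suc (suc (m ℕ.+ n)) · 1#)          ≡⟨ ≡.cong (λ k → - (k · 1#)) (≡.cong suc (ℕₚ.+-suc m n)) ⟨
    - ((suc m ℕ.+ suc n) · 1#)            ≈⟨ -‿cong (×-homo-+ 1# (suc m) (suc n)) ⟩
    - (suc m · 1# + suc n · 1#)           ≈⟨ -‿+-comm _ _ ⟨
    - (suc m · 1#) + - (suc n · 1#)       ∎

  ⟦⟧-* : ∀ i j → ⟦ i ℤ.* j ⟧ ≈ ⟦ i ⟧ * ⟦ j ⟧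
  ⟦⟧-* (+ m)    (+ n)    = trans (⟦⟧-+◃ (m ℕ.* n)) (×1-homo-* m n)
  ⟦⟧-* (+ m)    -[1+ n ] = trans (⟦⟧--◃ (m ℕ.* suc n))
    (trans (-‿cong (×1-homo-* m (suc n))) (-‿distribʳ-* _ _))
  ⟦⟧-* -[1+ m ] (+ n)    = trans (⟦⟧--◃ (suc m ℕ.* n))
    (trans (-‿cong (×1-homo-* (suc m) n)) (-‿distribˡ-* _ _))
  ⟦⟧-* -[1+ m ] -[1+ n ] = begin
    (suc m ℕ.* suc n) · 1#                ≈⟨ ×1-homo-* (suc m) (suc n) ⟩
    (suc m · 1#) * (suc n · 1#)           ≈⟨ -‿involutive _ ⟨
    - - ((suc m · 1#) * (suc n · 1#))     ≈⟨ -‿cong (-‿distribˡ-* _ _) ⟩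
    - (- (suc m · 1#) * (suc n · 1#))     ≈⟨ -‿distribʳ-* _ _ ⟩
    - (suc m · 1#) * - (suc n · 1#)       ∎

  ⟦⟧-neg : ∀ i → ⟦ ℤ.- i ⟧ ≈ - ⟦ i ⟧
  ⟦⟧-neg (+ zero)  = sym -0#≈0#
  ⟦⟧-neg (+ suc n) = refl
  ⟦⟧-neg -[1+ n ]  = sym (-‿involutive _)

  morphism : ℤ.+-*-rawRing -Raw-AlmostCommutative⟶ fromCommutativeRing R
  morphism = record
    { ⟦_⟧    = ⟦_⟧
    ; +-homo = ⟦⟧-+
    ; *-homo = ⟦⟧-*
    ; -‿homo = ⟦⟧-neg
    ; 0-homo = refl
    ; 1-homo = refl
    }

  open RingSolver ℤ.+-*-rawRing (fromCommutativeRing R) morphism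
    (λ i j → Maybe.map (λ i≡j → reflexive (≡.cong ⟦_⟧ i≡j)) (dec⇒maybe (i ℤₚ.≟ j)))
    public using (solve; _:=_; _:+_; _:*_; _:-_; :-_; con)

-- Arithmetic and inequalities in ordered fields.

module OrderedFieldProperties {c ℓ₁ ℓ₂} (F : OrderedField c ℓ₁ ℓ₂) where
  open OrderedField F
  open CommutativeRing commutativeRing public
    using (refl; sym; trans; reflexive; setoid; +-cong; +-congˡ; +-congʳ; *-cong; *-congˡ; *-congʳ; -‿cong; *-identityˡ; +-identityˡ; +-identityʳ; +-comm)
  open IsDecTotalOrder isDecTotalOrder public
    using (antisym; ≤-resp-≈)
    renaming (total to ≤-total; refl to ≤-refl; reflexive to ≤-reflexive; trans to ≤-trans)
  open IntegerCoefficientSolver commutativeRing public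
    using (solve; _:=_; _:+_; _:*_; _:-_; :-_; con; ⟦_⟧; ⟦+⟧)

  0≤y-x⇒x≤y : ∀ {x y} → 0# ≤ y - x → x ≤ y
  0≤y-x⇒x≤y {x} {y} p = proj₂ ≤-resp-≈ (solve 1 (λ x → con (+ 0) :+ x := x) refl x)
    (proj₁ ≤-resp-≈ (solve 2 (λ x y → y :- x :+ x := y) refl x y) (+-monoˡ-≤ x p))

  x≤y⇒0≤y-x : ∀ {x y} → x ≤ y → 0# ≤ y - x
  x≤y⇒0≤y-x {x} {y} p = proj₂ ≤-resp-≈ (solve 1 (λ x → x :- x := con (+ 0)) refl x)
    (+-monoˡ-≤ (- x) p)

  0≤-resp : ∀ {x y} → x ≈ y → 0# ≤ x → 0# ≤ y
  0≤-resp = proj₁ ≤-resp-≈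

  -- Inequalities are proved by writing the difference as a sum of products of
  -- non-negative terms; the equation is left to the ring solver.
  by-difference : ∀ {x y q} → 0# ≤ q → q ≈ y - x → x ≤ y
  by-difference 0≤q q≈y-x = 0≤y-x⇒x≤y (0≤-resp q≈y-x 0≤q)

  +-nonNeg : ∀ {x y} → 0# ≤ x → 0# ≤ y → 0# ≤ x + y
  +-nonNeg {x} {y} 0≤x 0≤y = ≤-trans 0≤y
    (proj₂ ≤-resp-≈ (solve 1 (λ y → con (+ 0) :+ y := y) refl y) (+-monoˡ-≤ y 0≤x))

  square-nonNeg : ∀ x → 0# ≤ x * x
  square-nonNeg x with ≤-total 0# x
  ... | inj₁ 0≤x = *-nonNeg 0≤x 0≤x
  ... | inj₂ x≤0 = 0≤-resp (solve 1 (λ x → (con (+ 0) :- x) :* (con (+ 0) :- x) := x :* x) refl x)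
                     (*-nonNeg (x≤y⇒0≤y-x x≤0) (x≤y⇒0≤y-x x≤0))

  0≤1 : 0# ≤ 1#
  0≤1 = 0≤-resp (*-identityˡ 1#) (square-nonNeg 1#)

  0≤fromℕ : ∀ n → 0# ≤ fromℕ n
  0≤fromℕ zero    = ≤-refl
  0≤fromℕ (suc n) = +-nonNeg 0≤1 (0≤fromℕ n)

  fromℕ-suc≰0 : ∀ n → ¬ (fromℕ (suc n) ≤ 0#)
  fromℕ-suc≰0 n n+1≤0 = 0≉1 (antisym 0≤1 (≤-trans
    (by-difference (0≤fromℕ n) (solve 2 (λ e n → n := e :+ n :- e) refl 1# (fromℕ n))) n+1≤0))

  -- Positivity of t is stated through the weak order as `¬ (t ≤ 0#)`. If x ≤ 0 then t x is both
  -- non-positive and non-negative, hence 0, and dividing by t gives x = 0. Claims involving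
  -- fractions are multiplied by a positive number and recovered here.
  *-cancelˡ-nonNeg : ∀ {t x} → ¬ (t ≤ 0#) → 0# ≤ t * x → 0# ≤ x
  *-cancelˡ-nonNeg {t} {x} t≰0 0≤tx with ≤-total 0# x
  ... | inj₁ 0≤x = 0≤x
  ... | inj₂ x≤0 = ≤-reflexive (sym x≈0)
    where
    0≤t : 0# ≤ t
    0≤t with ≤-total 0# t
    ... | inj₁ p = p
    ... | inj₂ p = contradiction p t≰0
    tx≤0 : t * x ≤ 0#
    tx≤0 = by-difference (*-nonNeg 0≤t (x≤y⇒0≤y-x x≤0))
      (solve 2 (λ t x → t :* (con (+ 0) :- x) := con (+ 0) :- t :* x) refl t x)
    x≈0 : x ≈ 0#
    x≈0 = begin
      x                ≈⟨ *-identityˡ x ⟨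
      1# * x           ≈⟨ *-congʳ (⁻¹-inverseʳ t (λ t≈0 → t≰0 (≤-reflexive t≈0))) ⟨
      t * t ⁻¹ * x     ≈⟨ solve 3 (λ t i x → t :* i :* x := i :* (t :* x)) refl t (t ⁻¹) x ⟩
      t ⁻¹ * (t * x)   ≈⟨ *-congˡ (antisym tx≤0 0≤tx) ⟩
      t ⁻¹ * 0#        ≈⟨ solve 1 (λ i → i :* con (+ 0) := con (+ 0)) refl (t ⁻¹) ⟩
      0#               ∎
      where open SetoidReasoning setoid

  0≤⟦+⟧ : ∀ n → 0# ≤ ⟦ + n ⟧
  0≤⟦+⟧ n = 0≤-resp (⟦+⟧ n) (0≤fromℕ n)

  ⟦+suc⟧≰0 : ∀ n → ¬ (⟦ + suc n ⟧ ≤ 0#)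
  ⟦+suc⟧≰0 n p = fromℕ-suc≰0 n (≤-trans (≤-reflexive (⟦+⟧ (suc n))) p)

  fromℕ-suc-*-/ : ∀ n x → fromℕ (suc n) * (x / fromℕ (suc n)) ≈ x
  fromℕ-suc-*-/ n x = begin
    m * (x * m ⁻¹)   ≈⟨ solve 3 (λ m x i → m :* (x :* i) := m :* i :* x) refl m x (m ⁻¹) ⟩
    m * m ⁻¹ * x     ≈⟨ *-congʳ (⁻¹-inverseʳ m (λ m≈0 → fromℕ-suc≰0 n (≤-reflexive m≈0))) ⟩
    1# * x           ≈⟨ *-identityˡ x ⟩
    x                ∎
    where
    open SetoidReasoning setoid
    m = fromℕ (suc n)

  x≈y⇒x-y≈0 : ∀ {x y} → x ≈ y → x - y ≈ 0#
  x≈y⇒x-y≈0 {x} {y} x≈y = trans (+-congʳ x≈y) (solve 1 (λ y → y :- y := con (+ 0)) refl y)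

-- Expected cost of a coin flip.

module CoinFlips {c ℓ₁ ℓ₂} (F : OrderedField c ℓ₁ ℓ₂) where
  open OrderedField F
  open OrderedFieldProperties F
  open Exploration F

  𝔼-pay : ∀ x r → 𝔼 (pay x r) ≈ x + 𝔼 r
  𝔼-pay x (return y)   = refl
  𝔼-pay x (coin p r t) = trans
    (+-cong (*-congˡ (𝔼-pay x r)) (*-congˡ (𝔼-pay x t)))
    (solve 4 (λ p x r t → p :* (x :+ r) :+ (con (+ 1) :- p) :* (x :+ t) := x :+ (p :* r :+ (con (+ 1) :- p) :* t)) refl p x (𝔼 r) (𝔼 t))

  module _ {α a b d : Carrier} (0≤αa : 0# ≤ α * a) where
    private
      t : Carrier
      t = b - d - a

      αa≤t : ¬ (b ≤ (α + 1#) * a + d) → 0# ≤ t - α * a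
      αa≤t b≰ with ≤-total b ((α + 1#) * a + d)
      ... | inj₁ b≤ = contradiction b≤ b≰
      ... | inj₂ ≤b = 0≤-resp (solve 4 (λ α a b d → b :- ((α :+ con (+ 1)) :* a :+ d) := b :- d :- a :- α :* a) refl α a b d) (x≤y⇒0≤y-x ≤b)

      -- From t ≤ 0 it would follow that b ≤ a + d ≤ (α + 1) a + d. So a random move has t > 0 even
      -- when a = 0, and dividing by t is legitimate.
      t≰0 : ¬ (b ≤ (α + 1#) * a + d) → ¬ (t ≤ 0#)
      t≰0 b≰ t≤0 = b≰ (by-difference (+-nonNeg (x≤y⇒0≤y-x t≤0) 0≤αa)
        (solve 4 (λ α a b d → con (+ 0) :- (b :- d :- a) :+ α :* a := (α :+ con (+ 1)) :* a :+ d :- b) refl α a b d))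

    -- An unforced direct move has probability α a / t, so the last hypothesis
    -- is the claim multiplied by t.
    coin-≤ : ∀ {x y X Y Z} →
      (b ≤ (α + 1#) * a + d → x ≤ Z) →
      (¬ (b ≤ (α + 1#) * a + d) → 0# ≤ t → x ≤ X × y ≤ Y × 0# ≤ α * a * (Z - X) + (t - α * a) * (Z - Y)) →
      p-dir α a b d * x + (1# - p-dir α a b d) * y ≤ Z
    coin-≤ {x} {y} {X} {Y} {Z} direct random with b ≤? (α + 1#) * a + d
    ... | yes b≤ = ≤-trans (≤-reflexive (solve 2 (λ x y → con (+ 1) :* x :+ (con (+ 1) :- con (+ 1)) :* y := x) refl x y)) (direct b≤)
    -- First x and y are replaced by X and Y, which needs p and 1 - p to be non-negative. The
    -- remaining inequality is multiplied by t, where t p = α a removes the fraction.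
    ... | no b≰ = ≤-trans
      (by-difference (+-nonNeg (*-nonNeg 0≤p (x≤y⇒0≤y-x x≤X)) (*-nonNeg 0≤1-p (x≤y⇒0≤y-x y≤Y)))
        (solve 5 (λ p x y X Y → p :* (X :- x) :+ (con (+ 1) :- p) :* (Y :- y) :=
                   p :* X :+ (con (+ 1) :- p) :* Y :- (p :* x :+ (con (+ 1) :- p) :* y)) refl p x y X Y))
      (0≤y-x⇒x≤y (*-cancelˡ-nonNeg (t≰0 b≰) (0≤-resp (begin
        α * a * (Z - X) + (t - α * a) * (Z - Y)   ≈⟨ +-cong (*-congʳ tp≈αa) (*-congʳ (+-congˡ (-‿cong tp≈αa))) ⟨
        t * p * (Z - X) + (t - t * p) * (Z - Y)   ≈⟨ solve 5 (λ t p X Y Z → t :* p :* (Z :- X) :+ (t :- t :* p) :* (Z :- Y) := t :* (Z :- (p :* X :+ (con (+ 1) :- p) :* Y))) refl t p X Y Z ⟩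
        t * (Z - (p * X + (1# - p) * Y))          ∎) 0≤Δ)))
      where
      open SetoidReasoning setoid
      p : Carrier
      p = a / t * α
      0≤t : 0# ≤ t
      0≤t = 0≤-resp (solve 2 (λ t s → t :- s :+ s := t) refl t (α * a)) (+-nonNeg (αa≤t b≰) 0≤αa)
      bounds = random b≰ 0≤t
      x≤X = proj₁ bounds
      y≤Y = proj₁ (proj₂ bounds)
      0≤Δ = proj₂ (proj₂ bounds)
      tp≈αa : t * p ≈ α * a
      tp≈αa = begin
        t * (a * t ⁻¹ * α)   ≈⟨ solve 4 (λ t a i α → t :* (a :* i :* α) := t :* i :* (α :* a)) refl t a (t ⁻¹) α ⟩
        t * t ⁻¹ * (α * a)   ≈⟨ *-congʳ (⁻¹-inverseʳ t (λ t≈0 → t≰0 b≰ (≤-reflexive t≈0))) ⟩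
        1# * (α * a)         ≈⟨ *-identityˡ _ ⟩
        α * a                ∎
      0≤p : 0# ≤ p
      0≤p = *-cancelˡ-nonNeg (t≰0 b≰) (0≤-resp (sym tp≈αa) 0≤αa)
      0≤1-p : 0# ≤ 1# - p
      0≤1-p = *-cancelˡ-nonNeg (t≰0 b≰) (0≤-resp (trans (+-congˡ (-‿cong (sym tp≈αa)))
        (solve 2 (λ t p → t :- t :* p := t :* (con (+ 1) :- p)) refl t p)) (αa≤t b≰))

-- The potential function and its decrease.

-- With t = b - d - a, repeat-ineq makes Φ below a supermartingale at a random
-- step after which Φ is used again, last-ineq at one after which no further
-- backtracking occurs.
record Parameters {c ℓ₁ ℓ₂} (F : OrderedField c ℓ₁ ℓ₂) : Set (c ⊔ ℓ₂) where
  open OrderedField F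
  field
    α μ : Carrier
    0≤α : 0# ≤ α
    0≤μ : 0# ≤ μ
    repeat-ineq : ∀ a t →
      0# ≤ α * a * (μ * (a + t)) - (t - α * a) * (a + a + μ * a - (α + μ) * (a + a + t))
    last-ineq : ∀ a t →
      0# ≤ t * ((α + μ) * (a + t) - μ * a) - (t - α * a) * (a + a)

module Potential {c ℓ₁ ℓ₂} {F : OrderedField c ℓ₁ ℓ₂} (P : Parameters F) where
  open OrderedField F
  open OrderedFieldProperties F
  open Parameters P

  0≤κ : 0# ≤ α + μ
  0≤κ = +-nonNeg 0≤α 0≤μ

  -- Bound on the expected remaining cost in state (a , b , d), where the total
  -- cost is to be compared with r + r.
  Φ : Carrier → Carrier → Carrier → Carrier
  Φ r a d = r + r - a + (α + μ) * (r - d) - μ * a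

  -- The move adds b to a, so Φ falls by (1 + μ) b: the cost b is paid and μ b is left over.
  Φ-direct : ∀ {r a b d} → 0# ≤ b → b + Φ r (a + b) d ≤ Φ r a d
  Φ-direct {r} {a} {b} {d} 0≤b = by-difference (*-nonNeg 0≤μ 0≤b)
    (solve 6 (λ α μ r a b d →
       let Φ = λ r a d → r :+ r :- a :+ (α :+ μ) :* (r :- d) :- μ :* a in
       μ :* b := Φ r a d :- (b :+ Φ r (a :+ b) d)) refl α μ r a b d)

  -- Backtracking exchanges the two sides, so the new state has d in place of a and a + b in place
  -- of d. In terms of a, t and d, the expression is the one of `repeat-ineq`, which is free of d,
  -- plus t μ d.
  Φ-random : ∀ {r a b d} → 0# ≤ d → 0# ≤ b - d - a →
    0# ≤ α * a * (Φ r a d - (b + Φ r (a + b) d)) + (b - d - a - α * a) * (Φ r a d - (a + d + Φ r d (a + b)))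
  Φ-random {r} {a} {b} {d} 0≤d 0≤t = 0≤-resp
    (solve 6 (λ α μ r a b d →
       let Φ = λ r a d → r :+ r :- a :+ (α :+ μ) :* (r :- d) :- μ :* a
           t = b :- d :- a in
       α :* a :* (μ :* (a :+ t)) :- (t :- α :* a) :* (a :+ a :+ μ :* a :- (α :+ μ) :* (a :+ a :+ t)) :+ t :* (μ :* d)
       := α :* a :* (Φ r a d :- (b :+ Φ r (a :+ b) d)) :+ (t :- α :* a) :* (Φ r a d :- (a :+ d :+ Φ r d (a :+ b)))) refl α μ r a b d)
    (+-nonNeg (repeat-ineq a (b - d - a)) (*-nonNeg 0≤t (*-nonNeg 0≤μ 0≤d)))

  -- Meant for the state after the first step, when exactly a has been paid.
  Φ-upper : ∀ {r a d} → 0# ≤ a → 0# ≤ d → a + Φ r a d ≤ r + r + (α + μ) * r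
  Φ-upper {r} {a} {d} 0≤a 0≤d = by-difference (+-nonNeg (*-nonNeg 0≤κ 0≤d) (*-nonNeg 0≤μ 0≤a))
    (solve 5 (λ α μ r a d → (α :+ μ) :* d :+ μ :* a := r :+ r :+ (α :+ μ) :* r :-
      (a :+ (r :+ r :- a :+ (α :+ μ) :* (r :- d) :- μ :* a))) refl α μ r a d)

  module _ {r a d : Carrier} (0≤a : 0# ≤ a) (0≤r-d-a : 0# ≤ r - d - a) where
    -- On a cycle of length 2r the left side is the cost of simply going on round the cycle. Since κ
    -- = α + μ, the surplus of Φ over it is κ (r - d - a) + α a.
    Φ-lower : r + r - a ≤ Φ r a d
    Φ-lower = by-difference (+-nonNeg (*-nonNeg 0≤κ 0≤r-d-a) (*-nonNeg 0≤α 0≤a))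
      (solve 5 (λ α μ r a d → (α :+ μ) :* (r :- d :- a) :+ α :* a :=
        r :+ r :- a :+ (α :+ μ) :* (r :- d) :- μ :* a :- (r :+ r :- a)) refl α μ r a d)

    -- Without later backtracking, going on costs 2r - a and backtracking costs (a + d) + (2r - d) =
    -- 2r + a. The worst case is r = b, where `last-ineq` is exactly what is needed; a larger r adds
    -- t κ (r - b).
    Φ-last-random : ∀ {b} → b ≤ r → 0# ≤ b - d - a →
      0# ≤ α * a * (Φ r a d - (r + r - a)) + (b - d - a - α * a) * (Φ r a d - (r + r + a))
    Φ-last-random {b} b≤r 0≤t = 0≤-resp
      (solve 6 (λ α μ r a b d →
        let Φ = r :+ r :- a :+ (α :+ μ) :* (r :- d) :- μ :* a
            t = b :- d :- a
            κ = α :+ μ in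
        t :* (κ :* (r :- b)) :+ (t :* (κ :* (a :+ t) :- μ :* a) :- (t :- α :* a) :* (a :+ a))
        := α :* a :* (Φ :- (r :+ r :- a)) :+ (t :- α :* a) :* (Φ :- (r :+ r :+ a))) refl α μ r a b d)
      (+-nonNeg (*-nonNeg 0≤t (*-nonNeg 0≤κ (x≤y⇒0≤y-x b≤r))) (last-ineq a (b - d - a)))

    -- Here r is the length of the cycle without the heavy edge, which is the direct edge. The
    -- threshold of the algorithm bounds its weight b by (α + 1) a + d ≤ r + α a, and the term α a
    -- is contained in Φ.
    Φ-heavy-direct : ∀ {b} → b ≤ (α + 1#) * a + d → r + b - a ≤ Φ r a d
    Φ-heavy-direct {b} b≤ = by-difference (+-nonNeg (+-nonNeg (x≤y⇒0≤y-x b≤) 0≤r-d-a) (*-nonNeg 0≤κ 0≤r-d-a))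
      (solve 6 (λ α μ r a b d → (α :+ con (+ 1)) :* a :+ d :- b :+ (r :- d :- a) :+ (α :+ μ) :* (r :- d :- a) :=
        r :+ r :- a :+ (α :+ μ) :* (r :- d) :- μ :* a :- (r :+ b :- a)) refl α μ r a b d)

    -- Avoiding the heavy edge costs 2r - a in all; crossing it costs b - r more. This happens with
    -- probability α a / t, and b - r = t - (r - d - a) ≤ t, so the expected extra cost is at most α
    -- a, which Φ covers.
    Φ-heavy-random : ∀ {b} → 0# ≤ b - d - a →
      0# ≤ α * a * (Φ r a d - (r + b - a)) + (b - d - a - α * a) * (Φ r a d - (r + r - a))
    Φ-heavy-random {b} 0≤t = 0≤-resp
      (solve 6 (λ α μ r a b d →
        let Φ = r :+ r :- a :+ (α :+ μ) :* (r :- d) :- μ :* a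
            t = b :- d :- a
            κ = α :+ μ in
        (α :* a :+ κ :* t) :* (r :- d :- a) := α :* a :* (Φ :- (r :+ b :- a)) :+ (t :- α :* a) :* (Φ :- (r :+ r :- a))) refl α μ r a b d)
      (*-nonNeg (+-nonNeg (*-nonNeg 0≤α 0≤a) (*-nonNeg 0≤κ 0≤t)) 0≤r-d-a)

-- The constants built from the square root of two.

record SquareRootOfTwo {c ℓ₁ ℓ₂} (F : OrderedField c ℓ₁ ℓ₂) : Set (c ⊔ ℓ₁ ⊔ ℓ₂) where
  open OrderedField F
  field
    √2      : Carrier
    0≤√2    : 0# ≤ √2
    √2*√2≈2 : √2 * √2 ≈ fromℕ 2

module Constants {c ℓ₁ ℓ₂} {F : OrderedField c ℓ₁ ℓ₂} (R : SquareRootOfTwo F) where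
  open OrderedField F
  open OrderedFieldProperties F
  open SquareRootOfTwo R

  -- γ is the excess of the ratio over 1. The choice of μ makes κ = α + μ equal to 2γ, because Φ
  -- compares the cost with 2r.
  α γ μ : Carrier
  α = 1# / fromℕ 2
  γ = (fromℕ 3 - √2) ^ 2 / fromℕ 8
  μ = γ + γ - α

  private
    u v z : Carrier
    u = ⟦ + 2 ⟧ * α - 1#
    v = ⟦ + 8 ⟧ * γ - (⟦ + 3 ⟧ - √2) * (⟦ + 3 ⟧ - √2)
    z = √2 * √2 - ⟦ + 2 ⟧

    u≈0 : u ≈ 0#
    u≈0 = x≈y⇒x-y≈0 (trans (*-congʳ (sym (⟦+⟧ 2))) (fromℕ-suc-*-/ 1 1#))

    v≈0 : v ≈ 0#
    v≈0 = x≈y⇒x-y≈0 (begin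
      ⟦ + 8 ⟧ * γ                           ≈⟨ *-congʳ (⟦+⟧ 8) ⟨
      fromℕ 8 * γ                           ≈⟨ fromℕ-suc-*-/ 7 _ ⟩
      (fromℕ 3 - √2) * ((fromℕ 3 - √2) * 1#)  ≈⟨ solve 1 (λ x → x :* (x :* con (+ 1)) := x :* x) refl _ ⟩
      (fromℕ 3 - √2) * (fromℕ 3 - √2)         ≈⟨ *-cong (+-congʳ (⟦+⟧ 3)) (+-congʳ (⟦+⟧ 3)) ⟩
      (⟦ + 3 ⟧ - √2) * (⟦ + 3 ⟧ - √2)         ∎)
      where open SetoidReasoning setoid

    z≈0 : z ≈ 0#
    z≈0 = x≈y⇒x-y≈0 (trans √2*√2≈2 (⟦+⟧ 2))

    -- The defining relations of α, γ and √2 are u = v = z = 0; the ring solver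
    -- does not know them, so multiples of u, v and z are added by hand.
    vanish : ∀ {x} f g h → x ≈ x + (u * f + v * g + z * h)
    vanish {x} f g h = sym (begin
      x + (u * f + v * g + z * h)      ≈⟨ +-congˡ (+-cong (+-cong (*-congʳ u≈0) (*-congʳ v≈0)) (*-congʳ z≈0)) ⟩
      x + (0# * f + 0# * g + 0# * h)   ≈⟨ solve 4 (λ x f g h → x :+ (con (+ 0) :* f :+ con (+ 0) :* g :+ con (+ 0) :* h) := x) refl x f g h ⟩
      x                                ∎)
      where open SetoidReasoning setoid

    -- A rational upper bound 10/7 for √2: (10 + 7√2)(10 - 7√2) = 100 - 98 = 2, and the first factor
    -- is positive.
    0≤10-7√2 : 0# ≤ ⟦ + 10 ⟧ - ⟦ + 7 ⟧ * √2
    0≤10-7√2 = *-cancelˡ-nonNeg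
      (λ p → ⟦+suc⟧≰0 9 (≤-trans (by-difference (*-nonNeg (0≤⟦+⟧ 7) 0≤√2)
        (solve 1 (λ √2 → con (+ 7) :* √2 := con (+ 10) :+ con (+ 7) :* √2 :- con (+ 10)) refl √2)) p))
      (0≤-resp (trans (vanish 0# 0# (- ⟦ + 49 ⟧))
        (solve 3 (λ √2 u v → con (+ 2) :+ (u :* con (+ 0) :+ v :* con (+ 0) :+ (√2 :* √2 :- con (+ 2)) :* (:- con (+ 49)))
          := (con (+ 10) :+ con (+ 7) :* √2) :* (con (+ 10) :- con (+ 7) :* √2)) refl √2 u v)) (0≤⟦+⟧ 2))

  0≤α : 0# ≤ α
  0≤α = *-cancelˡ-nonNeg (fromℕ-suc≰0 1) (0≤-resp (sym (fromℕ-suc-*-/ 1 1#)) 0≤1)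

  -- From 8γ = 11 - 6√2 one gets 4μ = 9 - 6√2, and hence 56μ = 126 - 84√2 = 12 (10 - 7√2) + 6.
  0≤μ : 0# ≤ μ
  0≤μ = *-cancelˡ-nonNeg (⟦+suc⟧≰0 55) (0≤-resp (trans (vanish (- ⟦ + 28 ⟧) ⟦ + 14 ⟧ ⟦ + 14 ⟧)
    (solve 3 (λ √2 α γ →
      let u = con (+ 2) :* α :- con (+ 1)
          v = con (+ 8) :* γ :- (con (+ 3) :- √2) :* (con (+ 3) :- √2)
          z = √2 :* √2 :- con (+ 2) in
      con (+ 12) :* (con (+ 10) :- con (+ 7) :* √2) :+ con (+ 6)
        :+ (u :* (:- con (+ 28)) :+ v :* con (+ 14) :+ z :* con (+ 14))
      := con (+ 56) :* (γ :+ γ :- α)) refl √2 α γ))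
    (+-nonNeg (*-nonNeg (0≤⟦+⟧ 12) 0≤10-7√2) (0≤⟦+⟧ 6)))

  -- Four times the left-hand side is ((3 - √2) t - √2 a)²; this perfect
  -- square is where the constant (3 - √2)² / 8 comes from.
  repeat-ineq : ∀ a t → 0# ≤ α * a * (μ * (a + t)) - (t - α * a) * (a + a + μ * a - (α + μ) * (a + a + t))
  repeat-ineq a t = *-cancelˡ-nonNeg (⟦+suc⟧≰0 3) (0≤-resp
    (trans (vanish (- (u * (a * t + ⟦ + 2 ⟧ * (a * a)))) (t * t + a * t) (- (a * t + a * a)))
    (solve 5 (λ √2 α γ a t →
      let u = con (+ 2) :* α :- con (+ 1)
          v = con (+ 8) :* γ :- (con (+ 3) :- √2) :* (con (+ 3) :- √2)
          z = √2 :* √2 :- con (+ 2)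
          μ = γ :+ γ :- α
          r = (con (+ 3) :- √2) :* t :- √2 :* a in
      r :* r :+ (u :* (:- (u :* (a :* t :+ con (+ 2) :* (a :* a)))) :+ v :* (t :* t :+ a :* t) :+ z :* (:- (a :* t :+ a :* a)))
      := con (+ 4) :* (α :* a :* (μ :* (a :+ t)) :- (t :- α :* a) :* (a :+ a :+ μ :* a :- (α :+ μ) :* (a :+ a :+ t))))
      refl √2 α γ a t)) (square-nonNeg ((⟦ + 3 ⟧ - √2) * t - √2 * a)))

  -- For α = 1/2 this is the quadratic form κ t² - (3/2) a t + a², non-negative because κ ≥ 9/16.
  -- Multiplying by 112 gives integer coefficients: 112κ = 24 (10 - 7√2) + 63 + 5, and 63 t²
  -- completes the square 7 (4a - 3t)².
  last-ineq : ∀ a t → 0# ≤ t * ((α + μ) * (a + t) - μ * a) - (t - α * a) * (a + a)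
  last-ineq a t = *-cancelˡ-nonNeg (⟦+suc⟧≰0 111) (0≤-resp
    (trans (vanish (⟦ + 56 ⟧ * (a * t) + ⟦ + 112 ⟧ * (a * a)) (⟦ + 28 ⟧ * (t * t)) (⟦ + 28 ⟧ * (t * t)))
    (solve 5 (λ √2 α γ a t →
      let u = con (+ 2) :* α :- con (+ 1)
          v = con (+ 8) :* γ :- (con (+ 3) :- √2) :* (con (+ 3) :- √2)
          z = √2 :* √2 :- con (+ 2)
          μ = γ :+ γ :- α
          r = con (+ 4) :* a :- con (+ 3) :* t in
      con (+ 24) :* (con (+ 10) :- con (+ 7) :* √2) :* (t :* t) :+ con (+ 7) :* (r :* r) :+ con (+ 5) :* (t :* t)
        :+ (u :* (con (+ 56) :* (a :* t) :+ con (+ 112) :* (a :* a)) :+ v :* (con (+ 28) :* (t :* t)) :+ z :* (con (+ 28) :* (t :* t)))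
      := con (+ 112) :* (t :* ((α :+ μ) :* (a :+ t) :- μ :* a) :- (t :- α :* a) :* (a :+ a)))
      refl √2 α γ a t))
    (+-nonNeg (+-nonNeg (*-nonNeg (*-nonNeg (0≤⟦+⟧ 24) 0≤10-7√2) (square-nonNeg t))
      (*-nonNeg (0≤⟦+⟧ 7) (square-nonNeg (⟦ + 4 ⟧ * a - ⟦ + 3 ⟧ * t)))) (*-nonNeg (0≤⟦+⟧ 5) (square-nonNeg t))))

  parameters : Parameters F
  parameters = record { 0≤α = 0≤α ; 0≤μ = 0≤μ ; repeat-ineq = repeat-ineq ; last-ineq = last-ineq }

-- Vertices, edges and arcs of the cycle.

%-absorbˡ-+ : ∀ m k n .{{_ : ℕ.NonZero n}} → (m % n ℕ.+ k) % n ≡ (m ℕ.+ k) % n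
%-absorbˡ-+ m k n = begin
  (m % n ℕ.+ k) % n               ≡⟨ %-distribˡ-+ (m % n) k n ⟩
  (m % n % n ℕ.+ k % n) % n       ≡⟨ ≡.cong (λ x → (x ℕ.+ k % n) % n) (m%n%n≡m%n m n) ⟩
  (m % n ℕ.+ k % n) % n           ≡⟨ %-distribˡ-+ m k n ⟨
  (m ℕ.+ k) % n                   ∎
  where open ≡.≡-Reasoning

opposite-involutive : ∀ δ → opposite (opposite δ) ≡ δ
opposite-involutive cw  = ≡.refl
opposite-involutive ccw = ≡.refl

module CycleProperties {c ℓ₁ ℓ₂} (F : OrderedField c ℓ₁ ℓ₂)
  (Γ : Exploration.WeightedCycle F) where
  open OrderedField F
  open OrderedFieldProperties F
  open Exploration.WeightedCycle Γ
  open DecMembership (_≟ᶠ_ {n}) using (_∈?_)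

  toℕ-mod : ∀ m → toℕ (m mod n) ≡ m % n
  toℕ-mod m = toℕ-fromℕ< (m%n<n m n)

  toℕ-steps-cw : ∀ k v → toℕ (steps cw k v) ≡ (toℕ v ℕ.+ k) % n
  toℕ-steps-cw zero    v = ≡.sym (≡.trans (≡.cong (_% n) (ℕₚ.+-identityʳ (toℕ v))) (m<n⇒m%n≡m (toℕ<n v)))
  toℕ-steps-cw (suc k) v = begin
    toℕ (steps cw k (step cw v))         ≡⟨ toℕ-steps-cw k (step cw v) ⟩
    (toℕ (step cw v) ℕ.+ k) % n          ≡⟨ ≡.cong (λ x → (x ℕ.+ k) % n) (toℕ-mod (toℕ v ℕ.+ 1)) ⟩
    ((toℕ v ℕ.+ 1) % n ℕ.+ k) % n        ≡⟨ %-absorbˡ-+ (toℕ v ℕ.+ 1) k n ⟩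
    (toℕ v ℕ.+ 1 ℕ.+ k) % n              ≡⟨ ≡.cong (_% n) (ℕₚ.+-assoc (toℕ v) 1 k) ⟩
    (toℕ v ℕ.+ suc k) % n                ∎
    where open ≡.≡-Reasoning

  -- In either order the shifts 1 and n - 1 add up to n, which is 0 modulo n.
  step-opposite : ∀ δ v → step (opposite δ) (step δ v) ≡ v
  step-opposite δ v = toℕ-injective (≡.trans (shifts δ) (≡.trans ([m+n]%n≡m%n (toℕ v) n) (m<n⇒m%n≡m (toℕ<n v))))
    where
    open ≡.≡-Reasoning
    twice : ∀ i j → toℕ ((toℕ ((toℕ v ℕ.+ i) mod n) ℕ.+ j) mod n) ≡ (toℕ v ℕ.+ (i ℕ.+ j)) % n
    twice i j = begin
      toℕ ((toℕ ((toℕ v ℕ.+ i) mod n) ℕ.+ j) mod n) ≡⟨ toℕ-mod (toℕ ((toℕ v ℕ.+ i) mod n) ℕ.+ j) ⟩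
      (toℕ ((toℕ v ℕ.+ i) mod n) ℕ.+ j) % n         ≡⟨ ≡.cong (λ x → (x ℕ.+ j) % n) (toℕ-mod (toℕ v ℕ.+ i)) ⟩
      ((toℕ v ℕ.+ i) % n ℕ.+ j) % n                 ≡⟨ %-absorbˡ-+ (toℕ v ℕ.+ i) j n ⟩
      (toℕ v ℕ.+ i ℕ.+ j) % n                       ≡⟨ ≡.cong (_% n) (ℕₚ.+-assoc (toℕ v) i j) ⟩
      (toℕ v ℕ.+ (i ℕ.+ j)) % n                     ∎
    shifts : ∀ δ → toℕ (step (opposite δ) (step δ v)) ≡ (toℕ v ℕ.+ n) % n
    shifts cw  = twice 1 (2 ℕ.+ extra)
    shifts ccw = ≡.trans (twice (2 ℕ.+ extra) 1) (≡.cong (λ x → (toℕ v ℕ.+ x) % n) (ℕₚ.+-comm (2 ℕ.+ extra) 1))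

  steps-+ : ∀ δ j k v → steps δ (j ℕ.+ k) v ≡ steps δ k (steps δ j v)
  steps-+ δ zero    k v = ≡.refl
  steps-+ δ (suc j) k v = steps-+ δ j k (step δ v)

  steps-suc : ∀ δ k v → steps δ (suc k) v ≡ step δ (steps δ k v)
  steps-suc δ k v = ≡.trans (≡.cong (λ j → steps δ j v) (ℕₚ.+-comm 1 k)) (steps-+ δ k 1 v)

  steps-opposite : ∀ δ k v → steps (opposite δ) k (steps δ k v) ≡ v
  steps-opposite δ zero    v = ≡.refl
  steps-opposite δ (suc k) v = begin
    steps δ′ k (step δ′ (steps δ (suc k) v))      ≡⟨ ≡.cong (steps δ′ k ∘ step δ′) (steps-suc δ k v) ⟩
    steps δ′ k (step δ′ (step δ (steps δ k v)))   ≡⟨ ≡.cong (steps δ′ k) (step-opposite δ _) ⟩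
    steps δ′ k (steps δ k v)                      ≡⟨ steps-opposite δ k v ⟩
    v                                             ∎
    where
    open ≡.≡-Reasoning
    δ′ = opposite δ

  steps-n : ∀ δ v → steps δ n v ≡ v
  steps-n cw  v = toℕ-injective (≡.trans (toℕ-steps-cw n v)
    (≡.trans ([m+n]%n≡m%n (toℕ v) n) (m<n⇒m%n≡m (toℕ<n v))))
  steps-n ccw v = ≡.trans (≡.cong (steps ccw n) (≡.sym (steps-n cw v))) (steps-opposite cw n v)

  -- The coordinate of v when the cycle is cut open just before z; n - z stands for -z modulo n, to
  -- stay within the naturals.
  position : Vertex → Vertex → ℕ
  position z v = (toℕ v ℕ.+ (n ℕ.∸ toℕ z)) % n

  position<n : ∀ z v → position z v ℕ.< n
  position<n z v = m%n<n (toℕ v ℕ.+ (n ℕ.∸ toℕ z)) n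

  private
    round-trip : ∀ (z : Vertex) x → toℕ z ℕ.+ (x ℕ.+ (n ℕ.∸ toℕ z)) ≡ x ℕ.+ n
    round-trip z x = begin
      toℕ z ℕ.+ (x ℕ.+ (n ℕ.∸ toℕ z))   ≡⟨ ℕₚ.+-assoc (toℕ z) x _ ⟨
      toℕ z ℕ.+ x ℕ.+ (n ℕ.∸ toℕ z)     ≡⟨ ≡.cong (ℕ._+ (n ℕ.∸ toℕ z)) (ℕₚ.+-comm (toℕ z) x) ⟩
      x ℕ.+ toℕ z ℕ.+ (n ℕ.∸ toℕ z)     ≡⟨ ℕₚ.+-assoc x (toℕ z) _ ⟩
      x ℕ.+ (toℕ z ℕ.+ (n ℕ.∸ toℕ z))   ≡⟨ ≡.cong (x ℕ.+_) (ℕₚ.m+[n∸m]≡n (toℕ≤n z)) ⟩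
      x ℕ.+ n                           ∎
      where open ≡.≡-Reasoning

  steps-position : ∀ z v → steps cw (position z v) z ≡ v
  steps-position z v = toℕ-injective (begin
    toℕ (steps cw (position z v) z)                       ≡⟨ toℕ-steps-cw (position z v) z ⟩
    (toℕ z ℕ.+ position z v) % n                          ≡⟨ ≡.cong (_% n) (ℕₚ.+-comm (toℕ z) _) ⟩
    (position z v ℕ.+ toℕ z) % n                          ≡⟨ %-absorbˡ-+ (toℕ v ℕ.+ (n ℕ.∸ toℕ z)) (toℕ z) n ⟩
    (toℕ v ℕ.+ (n ℕ.∸ toℕ z) ℕ.+ toℕ z) % n               ≡⟨ ≡.cong (_% n) (ℕₚ.+-comm _ (toℕ z)) ⟩
    (toℕ z ℕ.+ (toℕ v ℕ.+ (n ℕ.∸ toℕ z))) % n             ≡⟨ ≡.cong (_% n) (round-trip z (toℕ v)) ⟩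
    (toℕ v ℕ.+ n) % n                                     ≡⟨ [m+n]%n≡m%n (toℕ v) n ⟩
    toℕ v % n                                             ≡⟨ m<n⇒m%n≡m (toℕ<n v) ⟩
    toℕ v                                                 ∎)
    where open ≡.≡-Reasoning

  position-steps : ∀ z {j} → j ℕ.< n → position z (steps cw j z) ≡ j
  position-steps z {j} j<n = begin
    (toℕ (steps cw j z) ℕ.+ (n ℕ.∸ toℕ z)) % n      ≡⟨ ≡.cong (λ x → (x ℕ.+ (n ℕ.∸ toℕ z)) % n) (toℕ-steps-cw j z) ⟩
    ((toℕ z ℕ.+ j) % n ℕ.+ (n ℕ.∸ toℕ z)) % n       ≡⟨ %-absorbˡ-+ (toℕ z ℕ.+ j) (n ℕ.∸ toℕ z) n ⟩
    (toℕ z ℕ.+ j ℕ.+ (n ℕ.∸ toℕ z)) % n             ≡⟨ ≡.cong (_% n) (ℕₚ.+-assoc (toℕ z) j _) ⟩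
    (toℕ z ℕ.+ (j ℕ.+ (n ℕ.∸ toℕ z))) % n           ≡⟨ ≡.cong (_% n) (round-trip z j) ⟩
    (j ℕ.+ n) % n                                   ≡⟨ [m+n]%n≡m%n j n ⟩
    j % n                                           ≡⟨ m<n⇒m%n≡m j<n ⟩
    j                                               ∎
    where open ≡.≡-Reasoning

  weight-nonNeg : ∀ δ v → 0# ≤ weight δ v
  weight-nonNeg cw  v = w-nonNeg v
  weight-nonNeg ccw v = w-nonNeg (step ccw v)

  weight-opposite : ∀ δ v → weight (opposite δ) v ≡ weight δ (step (opposite δ) v)
  weight-opposite cw  v = ≡.refl
  weight-opposite ccw v = ≡.cong w (≡.sym (step-opposite cw v))

  edge : Direction → Vertex → ℕ → Carrier
  edge δ v k = weight δ (steps δ k v)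

  -- An edge with j edges between it and v on one side has n - 1 - j on the other. Going j′ steps
  -- backwards from v arrives at its far end, the vertex j + 1 steps forwards.
  edge-opposite : ∀ δ v {j j′} → suc (j ℕ.+ j′) ≡ n → edge (opposite δ) v j′ ≡ edge δ v j
  edge-opposite δ v {j} {j′} j+j′+1≡n = begin
    weight δ′ (steps δ′ j′ v)                      ≡⟨ ≡.cong (weight δ′) meet ⟩
    weight δ′ (step δ (steps δ j v))               ≡⟨ weight-opposite δ _ ⟩
    weight δ (step δ′ (step δ (steps δ j v)))      ≡⟨ ≡.cong (weight δ) (step-opposite δ _) ⟩
    weight δ (steps δ j v)                         ∎
    where
    open ≡.≡-Reasoning
    δ′ = opposite δ
    meet : steps δ′ j′ v ≡ step δ (steps δ j v)
    meet = begin
      steps δ′ j′ v                                ≡⟨ ≡.cong (steps δ′ j′) (steps-n δ v) ⟨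
      steps δ′ j′ (steps δ n v)                    ≡⟨ ≡.cong (λ k → steps δ′ j′ (steps δ k v)) j+j′+1≡n ⟨
      steps δ′ j′ (steps δ (suc j ℕ.+ j′) v)       ≡⟨ ≡.cong (steps δ′ j′) (steps-+ δ (suc j) j′ v) ⟩
      steps δ′ j′ (steps δ j′ (steps δ (suc j) v)) ≡⟨ steps-opposite δ j′ _ ⟩
      steps δ (suc j) v                            ≡⟨ steps-suc δ j v ⟩
      step δ (steps δ j v)                         ∎

  arc-suc : ∀ δ v k → arc δ v (suc k) ≈ arc δ v k + edge δ v k
  arc-suc δ v zero    = solve 1 (λ x → x :+ con (+ 0) := con (+ 0) :+ x) refl (weight δ v)
  arc-suc δ v (suc k) = trans (+-congˡ (arc-suc δ (step δ v) k))
    (solve 3 (λ x y z → x :+ (y :+ z) := x :+ y :+ z) refl _ _ _)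

  arc-nonNeg : ∀ δ v k → 0# ≤ arc δ v k
  arc-nonNeg δ v zero    = ≤-refl
  arc-nonNeg δ v (suc k) = +-nonNeg (weight-nonNeg δ v) (arc-nonNeg δ (step δ v) k)

  arc-mono : ∀ δ v {j k} → j ℕ.≤ k → arc δ v j ≤ arc δ v k
  arc-mono δ v {k = k} z≤n = arc-nonNeg δ v k
  arc-mono δ v (s≤s j≤k) = by-difference (x≤y⇒0≤y-x (arc-mono δ (step δ v) j≤k))
    (solve 3 (λ x y z → z :- y := x :+ z :- (x :+ y)) refl (weight δ v) _ _)

  -- Induction on k: the outermost edge of the opposite arc is the next edge of the forward arc, so
  -- edges pass one by one from the one to the other.
  arc-complement : ∀ δ v j k → j ℕ.+ k ≡ n → arc δ v j + arc (opposite δ) v k ≈ arc δ v n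
  arc-complement δ v j zero    j≡n = trans (solve 1 (λ x → x :+ con (+ 0) := x) refl (arc δ v j))
    (reflexive (≡.cong (arc δ v) (≡.trans (≡.sym (ℕₚ.+-identityʳ j)) j≡n)))
  arc-complement δ v j (suc k) j+k+1≡n = begin
    arc δ v j + arc δ′ v (suc k)            ≈⟨ +-congˡ (arc-suc δ′ v k) ⟩
    arc δ v j + (arc δ′ v k + edge δ′ v k)  ≈⟨ +-congˡ (+-congˡ (reflexive (edge-opposite δ v {j} {k} j+k+1))) ⟩
    arc δ v j + (arc δ′ v k + edge δ v j)   ≈⟨ solve 3 (λ x y z → x :+ (y :+ z) := x :+ z :+ y) refl _ _ _ ⟩
    arc δ v j + edge δ v j + arc δ′ v k     ≈⟨ +-congʳ (arc-suc δ v j) ⟨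
    arc δ v (suc j) + arc δ′ v k            ≈⟨ arc-complement δ v (suc j) k j+k+1 ⟩
    arc δ v n                               ∎
    where
    open SetoidReasoning setoid
    δ′ = opposite δ
    j+k+1 : suc (j ℕ.+ k) ≡ n
    j+k+1 = ≡.trans (≡.sym (ℕₚ.+-suc j k)) j+k+1≡n

  arc-opposite-n : ∀ δ v → arc (opposite δ) v n ≈ arc δ v n
  arc-opposite-n δ v = trans (solve 1 (λ x → x := con (+ 0) :+ x) refl _) (arc-complement δ v 0 n ≡.refl)

  total : Carrier
  total = arc cw zero n

  -- Shifting the start drops the edge at v in front and gains the same edge at the end.
  arc-n-step : ∀ v → arc cw (step cw v) n ≈ arc cw v n
  arc-n-step v = begin
    arc cw (step cw v) n                           ≈⟨ solve 2 (λ x y → y := x :+ y :- x) refl (w v) _ ⟩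
    arc cw v (suc n) - w v                         ≈⟨ +-congʳ (arc-suc cw v n) ⟩
    arc cw v n + w (steps cw n v) - w v            ≈⟨ +-congʳ (+-congˡ (reflexive (≡.cong w (steps-n cw v)))) ⟩
    arc cw v n + w v - w v                         ≈⟨ solve 2 (λ x y → y :+ x :- x := y) refl (w v) _ ⟩
    arc cw v n                                     ∎
    where open SetoidReasoning setoid

  arc-n-steps : ∀ k v → arc cw (steps cw k v) n ≈ arc cw v n
  arc-n-steps zero    v = refl
  arc-n-steps (suc k) v = trans (arc-n-steps k (step cw v)) (arc-n-step v)

  arc-n : ∀ δ v → arc δ v n ≈ total
  arc-n cw  v = trans (reflexive (≡.cong (λ u → arc cw u n) (≡.sym (steps-position zero v)))) (arc-n-steps (position zero v) zero)
  arc-n ccw v = trans (arc-opposite-n cw v) (arc-n cw v)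

  steps-position-zero : ∀ v → steps cw (toℕ v) zero ≡ v
  steps-position-zero v = toℕ-injective (≡.trans (toℕ-steps-cw (toℕ v) zero) (m<n⇒m%n≡m (toℕ<n v)))

  private
    edge-zero : ∀ v → edge cw zero (toℕ v) ≈ w v
    edge-zero v = reflexive (≡.cong w (steps-position-zero v))
    -- On the path of all n edges from vertex 0, edge i lies among the first j edges, and edge j
    -- comes directly after them.
    ordered : ∀ i j → toℕ i ℕ.< toℕ j → w i + w j ≤ total
    ordered i j i<j = ≤-trans
      (by-difference (+-nonNeg (arc-nonNeg cw zero (toℕ i)) (x≤y⇒0≤y-x (arc-mono cw zero i<j)))
        (begin
          arc cw zero (toℕ i) + (arc cw zero (toℕ j) - arc cw zero (suc (toℕ i)))
            ≈⟨ +-congˡ (+-congˡ (-‿cong (trans (arc-suc cw zero (toℕ i)) (+-congˡ (edge-zero i))))) ⟩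
          arc cw zero (toℕ i) + (arc cw zero (toℕ j) - (arc cw zero (toℕ i) + w i))
            ≈⟨ solve 4 (λ x y u v → x :+ (y :- (x :+ u)) := y :+ v :- (u :+ v)) refl _ _ (w i) (w j) ⟩
          arc cw zero (toℕ j) + w j - (w i + w j)
            ≈⟨ +-congʳ (trans (arc-suc cw zero (toℕ j)) (+-congˡ (edge-zero j))) ⟨
          arc cw zero (suc (toℕ j)) - (w i + w j) ∎))
      (arc-mono cw zero (toℕ<n j))
      where open SetoidReasoning setoid

  edges-≤-total : ∀ {i j} → i ≢ j → w i + w j ≤ total
  edges-≤-total {i} {j} i≢j with ℕₚ.≤-total (toℕ i) (toℕ j)
  ... | inj₁ i≤j = ordered i j (ℕₚ.≤∧≢⇒< i≤j (i≢j ∘ toℕ-injective))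
  ... | inj₂ j≤i = ≤-trans (≤-reflexive (+-comm (w i) (w j)))
                     (ordered j i (ℕₚ.≤∧≢⇒< j≤i (i≢j ∘ toℕ-injective ∘ ≡.sym)))

  edgeIndex : Direction → Vertex → Vertex
  edgeIndex cw  v = v
  edgeIndex ccw v = step ccw v

  w-edgeIndex : ∀ δ v → weight δ v ≡ w (edgeIndex δ v)
  w-edgeIndex cw  v = ≡.refl
  w-edgeIndex ccw v = ≡.refl

  -- Lower bounds on the length of a tour.

  edges : ∀ {u v} → Walk u v → List Vertex
  edges stop               = []
  edges (move {u = u} δ p) = edgeIndex δ u ∷ edges p

  sumW : List Vertex → Carrier
  sumW []       = 0#
  sumW (x ∷ xs) = w x + sumW xs

  sumW-edges : ∀ {u v} (p : Walk u v) → sumW (edges p) ≈ length p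
  sumW-edges stop               = refl
  sumW-edges (move {u = u} δ p) = +-cong (reflexive (≡.sym (w-edgeIndex δ u))) (sumW-edges p)

  sumW-nonNeg : ∀ xs → 0# ≤ sumW xs
  sumW-nonNeg []       = ≤-refl
  sumW-nonNeg (x ∷ xs) = +-nonNeg (w-nonNeg x) (sumW-nonNeg xs)

  sumW-─ : ∀ {x xs} (x∈xs : x ∈ xs) → sumW xs ≈ sumW (xs ─ x∈xs) + w x
  sumW-─ (here ≡.refl)              = +-comm _ _
  sumW-─ {xs = y ∷ xs} (there x∈xs) = trans (+-congˡ (sumW-─ x∈xs))
    (solve 3 (λ x y z → x :+ (y :+ z) := x :+ y :+ z) refl _ _ _)

  ∈-─ : ∀ {x y : Vertex} {xs} (x∈xs : x ∈ xs) → y ∈ xs → y ≢ x → y ∈ (xs ─ x∈xs)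
  ∈-─ (here ≡.refl) (here y≡x)   y≢x = contradiction y≡x y≢x
  ∈-─ (here ≡.refl) (there y∈xs) y≢x = y∈xs
  ∈-─ (there x∈xs)  (here y≡z)   y≢x = here y≡z
  ∈-─ (there x∈xs)  (there y∈xs) y≢x = there (∈-─ x∈xs y∈xs y≢x)

  -- At most n consecutive edges are pairwise distinct, since their positions differ. So the last
  -- one can be removed from the list without losing the earlier ones, and induction applies.
  arc-≤-sumW : ∀ z k {xs} → k ℕ.≤ n → (∀ j → j ℕ.< k → steps cw j z ∈ xs) → arc cw z k ≤ sumW xs
  arc-≤-sumW z zero    {xs} _   _  = sumW-nonNeg xs
  arc-≤-sumW z (suc k) {xs} k<n on = bound
    where
    last : steps cw k z ∈ xs
    last = on k ℕₚ.≤-refl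
    distinct : ∀ j → j ℕ.< k → steps cw j z ≢ steps cw k z
    distinct j j<k eq = ℕₚ.<⇒≢ j<k (≡.trans (≡.sym (position-steps z (ℕₚ.<-trans j<k k<n)))
      (≡.trans (≡.cong (position z) eq) (position-steps z k<n)))
    bound : arc cw z (suc k) ≤ sumW xs
    bound = ≤-trans (≤-reflexive (arc-suc cw z k)) (≤-trans
      (+-monoˡ-≤ (edge cw z k) (arc-≤-sumW z k (ℕₚ.<⇒≤ k<n)
        (λ j j<k → ∈-─ last (on j (ℕₚ.m<n⇒m<1+n j<k)) (distinct j j<k))))
      (≤-reflexive (sym (sumW-─ last))))

  record Split {u v} (p : Walk u v) (x : Vertex) : Set (c ⊔ ℓ₁) where
    field
      before  : Walk u x
      after   : Walk x v
      length≈ : length p ≈ length before + length after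
      before⊆ : ∀ {e} → e ∈ edges before → e ∈ edges p
      after⊆  : ∀ {e} → e ∈ edges after → e ∈ edges p
      visits  : ∀ {y} → y ∈ visited p → y ∈ visited before ⊎ y ∈ visited after

  split : ∀ {u v x} (p : Walk u v) → x ∈ visited p → Split p x
  split p@stop (here ≡.refl) = record
    { before = stop ; after = p ; length≈ = sym (+-identityˡ _)
    ; before⊆ = λ () ; after⊆ = λ e∈ → e∈ ; visits = inj₂ }
  split p@(move _ _) (here ≡.refl) = record
    { before = stop ; after = p ; length≈ = sym (+-identityˡ _)
    ; before⊆ = λ () ; after⊆ = λ e∈ → e∈ ; visits = inj₂ }
  split (move {u = u} δ p) (there x∈p) = record
    { before  = move δ before
    ; after   = after
    ; length≈ = trans (+-congˡ length≈) (solve 3 (λ x y z → x :+ (y :+ z) := x :+ y :+ z) refl _ _ _)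
    ; before⊆ = λ where
        (here e≡)  → here e≡
        (there e∈) → there (before⊆ e∈)
    ; after⊆  = there ∘ after⊆
    ; visits  = λ where
        (here y≡)  → inj₁ (here y≡)
        (there y∈) → [ inj₁ ∘ there , inj₂ ]′ (visits y∈)
    }
    where open Split (split p x∈p)

  -- Removing an unused edge i turns the cycle into a path from its end z to i.
  -- The distance from z along this path changes by at most the length of a walk.
  module _ (i : Vertex) where
    private
      z : Vertex
      z = step cw i

      steps-z : steps cw (2 ℕ.+ extra) z ≡ i
      steps-z = steps-n cw i

    distance : Vertex → Carrier
    distance v = arc cw z (position z v)

    distance-z : distance z ≈ 0#
    distance-z = reflexive (≡.cong (arc cw z) (position-steps z {0} (s≤s z≤n)))

    distance-i : distance i ≈ total - w i
    distance-i = begin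
      distance i                                            ≈⟨ reflexive (≡.cong (arc cw z) (≡.trans (≡.cong (position z) (≡.sym steps-z)) (position-steps z ℕₚ.≤-refl))) ⟩
      arc cw z (2 ℕ.+ extra)                                ≈⟨ solve 2 (λ x y → x := x :+ y :- y) refl _ (w i) ⟩
      arc cw z (2 ℕ.+ extra) + w i - w i                    ≈⟨ +-congʳ (+-congˡ (reflexive (≡.cong w steps-z))) ⟨
      arc cw z (2 ℕ.+ extra) + edge cw z (2 ℕ.+ extra) - w i ≈⟨ +-congʳ (arc-suc cw z (2 ℕ.+ extra)) ⟨
      arc cw z n - w i                                      ≈⟨ +-congʳ (arc-n cw z) ⟩
      total - w i                                           ∎
      where open SetoidReasoning setoid

    distance-step : ∀ {v} → v ≢ i → distance (step cw v) ≈ distance v + w v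
    distance-step {v} v≢i = begin
      arc cw z (position z (step cw v))                 ≈⟨ reflexive (≡.cong (arc cw z) position-suc) ⟩
      arc cw z (suc k)                                  ≈⟨ arc-suc cw z k ⟩
      arc cw z k + edge cw z k                          ≈⟨ +-congˡ (reflexive (≡.cong w (steps-position z v))) ⟩
      distance v + w v                                  ∎
      where
      open SetoidReasoning setoid
      k : ℕ
      k = position z v
      -- The largest position n - 1 belongs to i alone, so from any other vertex the position grows
      -- by 1 without wrapping round.
      k≢n-1 : k ≢ 2 ℕ.+ extra
      k≢n-1 eq = v≢i (≡.trans (≡.sym (steps-position z v)) (≡.trans (≡.cong (λ k → steps cw k z) eq) steps-z))
      position-suc : position z (step cw v) ≡ suc k
      position-suc = ≡.trans (≡.cong (position z) (≡.trans (≡.cong (step cw) (≡.sym (steps-position z v))) (≡.sym (steps-suc cw k z))))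
        (position-steps z (s≤s (ℕₚ.≤∧≢⇒< (ℕₚ.≤-pred (position<n z v)) k≢n-1)))

    distance-lipschitz : ∀ {u v} (p : Walk u v) → i ∉ edges p →
      distance u ≤ distance v + length p × distance v ≤ distance u + length p
    distance-lipschitz stop _ = ≤-reflexive (sym (+-identityʳ _)) , ≤-reflexive (sym (+-identityʳ _))
    distance-lipschitz {u} {v} (move cw p) i∉ =
      by-difference (+-nonNeg (x≤y⇒0≤y-x (proj₁ IH)) (+-nonNeg (w-nonNeg u) (w-nonNeg u)))
        (trans (+-congʳ (+-congˡ (-‿cong (distance-step (i∉ ∘ here ∘ ≡.sym)))))
          (solve 4 (λ x y l w → y :+ l :- (x :+ w) :+ (w :+ w) := y :+ (w :+ l) :- x) refl (distance u) (distance v) (length p) (w u)))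
      , ≤-trans (proj₂ IH) (≤-reflexive (trans (+-congʳ (distance-step (i∉ ∘ here ∘ ≡.sym)))
          (solve 3 (λ x w l → x :+ w :+ l := x :+ (w :+ l)) refl (distance u) (w u) (length p))))
      where IH = distance-lipschitz p (i∉ ∘ there)
    distance-lipschitz {u} {v} (move ccw p) i∉ =
      ≤-trans (≤-reflexive back) (≤-trans (+-monoˡ-≤ (w u′) (proj₁ IH))
        (≤-reflexive (solve 3 (λ y l w → y :+ l :+ w := y :+ (w :+ l)) refl (distance v) (length p) (w u′))))
      , by-difference (+-nonNeg (x≤y⇒0≤y-x (proj₂ IH)) (+-nonNeg (w-nonNeg u′) (w-nonNeg u′)))
        (trans (solve 4 (λ x y l w → x :+ l :- y :+ (w :+ w) := x :+ w :+ (w :+ l) :- y) refl (distance u′) (distance v) (length p) (w u′))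
          (+-congʳ (+-congʳ (sym back))))
      where
      IH = distance-lipschitz p (i∉ ∘ there)
      u′ : Vertex
      u′ = step ccw u
      back : distance u ≈ distance u′ + w u′
      back = trans (reflexive (≡.cong distance (≡.sym (step-opposite ccw u)))) (distance-step (i∉ ∘ here ∘ ≡.sym))

    -- The walk has to go from one end of the path to the other and back. Cut at z and at i it has
    -- three pieces; adding their distance estimates cancels the base point v and leaves twice the
    -- distance from z to i.
    closed-walk-≥ : ∀ {v} (p : Walk v v) → z ∈ visited p → i ∈ visited p → i ∉ edges p →
      (total - w i) + (total - w i) ≤ length p
    closed-walk-≥ {v} p z∈p i∈p i∉p = ≤-trans (≤-reflexive (sym (+-cong distance-i distance-i)))
      ([ i-before , i-after ]′ (visits i∈p))
      where
      open Split (split p z∈p)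
      i-before : i ∈ visited before → distance i + distance i ≤ length p
      i-before i∈ = by-difference
        (+-nonNeg (+-nonNeg (x≤y⇒0≤y-x (proj₂ (distance-lipschitz S.before (i∉p ∘ before⊆ ∘ S.before⊆))))
                            (x≤y⇒0≤y-x (proj₁ (distance-lipschitz S.after (i∉p ∘ before⊆ ∘ S.after⊆)))))
                  (x≤y⇒0≤y-x (proj₂ (distance-lipschitz after (i∉p ∘ after⊆)))))
        (trans (solve 6 (λ dv dz di a b c → dv :+ a :- di :+ (dz :+ b :- di) :+ (dz :+ c :- dv) :=
            a :+ b :+ c :+ (dz :+ dz) :- (di :+ di)) refl (distance v) (distance z) (distance i) (length S.before) (length S.after) (length after))
          (+-congʳ (trans (+-cong (sym (trans length≈ (+-congʳ S.length≈))) (+-cong distance-z distance-z))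
            (solve 1 (λ x → x :+ (con (+ 0) :+ con (+ 0)) := x) refl (length p)))))
        where module S = Split (split before i∈)
      i-after : i ∈ visited after → distance i + distance i ≤ length p
      i-after i∈ = by-difference
        (+-nonNeg (+-nonNeg (x≤y⇒0≤y-x (proj₁ (distance-lipschitz before (i∉p ∘ before⊆))))
                            (x≤y⇒0≤y-x (proj₂ (distance-lipschitz S.before (i∉p ∘ after⊆ ∘ S.before⊆)))))
                  (x≤y⇒0≤y-x (proj₁ (distance-lipschitz S.after (i∉p ∘ after⊆ ∘ S.after⊆)))))
        (trans (solve 6 (λ dv dz di a b c → dz :+ a :- dv :+ (dz :+ b :- di) :+ (dv :+ c :- di) :=
            a :+ (b :+ c) :+ (dz :+ dz) :- (di :+ di)) refl (distance v) (distance z) (distance i) (length before) (length S.before) (length S.after))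
          (+-congʳ (trans (+-cong (sym (trans length≈ (+-congˡ S.length≈))) (+-cong distance-z distance-z))
            (solve 1 (λ x → x :+ (con (+ 0) :+ con (+ 0)) := x) refl (length p)))))
        where module S = Split (split after i∈)

  tour-≥ : ∀ t → total ≤ tourLength t ⊎ (∃[ i ] (total - w i) + (total - w i) ≤ tourLength t)
  tour-≥ t with all? (λ i → i ∈? edges (Tour.walk t))
  ... | yes all-used = inj₁ (≤-trans (arc-≤-sumW zero n ℕₚ.≤-refl (λ j _ → all-used (steps cw j zero)))
                              (≤-reflexive (sumW-edges (Tour.walk t))))
  ... | no ¬all-used with ¬∀⟶∃¬ n _ (λ i → i ∈? edges (Tour.walk t)) ¬all-used
  ...   | i , i∉ = inj₂ (i , closed-walk-≥ i (Tour.walk t) (Tour.visitsAll t _) (Tour.visitsAll t i) i∉)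

-- States of the algorithm and forced moves.

module Analysis {c ℓ₁ ℓ₂} {F : OrderedField c ℓ₁ ℓ₂} (P : Parameters F)
  (tie : Exploration.TieBreaking F) (Γ : Exploration.WeightedCycle F) (s : Exploration.WeightedCycle.Vertex Γ)
  where
  open OrderedField F
  open OrderedFieldProperties F
  open Exploration F
  open WeightedCycle Γ
  open CoinFlips F
  open Parameters P using (α; μ; 0≤α)
  open Potential P
  open CycleProperties F Γ
  open Min totalOrder using (x⊓y≤x; x⊓y≤y)

  expected : ℕ → Direction → ℕ → ℕ → Carrier
  expected u δ k m = 𝔼 (explore α tie Γ s u δ k m)

  private
    a b d : Direction → ℕ → Carrier
    a δ k = arc δ s k
    b δ k = edge δ s k
    d δ m = arc (opposite δ) s (suc m)

  a-suc : ∀ δ k → a δ (suc k) ≈ a δ k + b δ k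
  a-suc δ k = arc-suc δ s k

  -- After backtracking, the declined direct edge is the new backtracking edge.
  d-opposite : ∀ δ k → d (opposite δ) k ≈ a δ k + b δ k
  d-opposite δ k = trans (reflexive (≡.cong (λ ε → arc ε s (suc k)) (opposite-involutive δ))) (a-suc δ k)

  arcs-≤-total : ∀ δ {j k} → j ℕ.+ k ℕ.≤ n → arc δ s j + arc (opposite δ) s k ≤ total
  arcs-≤-total δ {j} {k} j+k≤n = by-difference
    (x≤y⇒0≤y-x (arc-mono (opposite δ) s (≡.subst (ℕ._≤ n ℕ.∸ j) (ℕₚ.m+n∸m≡n j k) (ℕₚ.∸-monoˡ-≤ j j+k≤n))))
    (begin
      arc (opposite δ) s (n ℕ.∸ j) - arc (opposite δ) s k              ≈⟨ solve 3 (λ x y z → z :- y := x :+ z :- (x :+ y)) refl (arc δ s j) _ _ ⟩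
      arc δ s j + arc (opposite δ) s (n ℕ.∸ j) - (arc δ s j + arc (opposite δ) s k)
                                                                       ≈⟨ +-congʳ (trans (arc-complement δ s j (n ℕ.∸ j) (ℕₚ.m+[n∸m]≡n (ℕₚ.≤-trans (ℕₚ.m≤m+n j k) j+k≤n))) (arc-n δ s)) ⟩
      total - (arc δ s j + arc (opposite δ) s k)                       ∎)
    where open SetoidReasoning setoid

  -- The explored path has k + m + 1 vertices, s included, and u vertices are left.
  Invariant : ℕ → ℕ → ℕ → Set
  Invariant u k m = k ℕ.+ m ℕ.+ suc u ≡ n

  direct-invariant : ∀ {u k m} → Invariant (suc u) k m → Invariant u (suc k) m
  direct-invariant {u} {k} {m} inv = ≡.trans (≡.sym (ℕₚ.+-suc (k ℕ.+ m) (suc u))) inv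

  backtrack-invariant : ∀ {u k m} → Invariant (suc u) k m → Invariant u (suc m) k
  backtrack-invariant {u} {k} {m} inv =
    ≡.trans (≡.cong (λ x → suc (x ℕ.+ suc u)) (ℕₚ.+-comm m k)) (direct-invariant {u} {k} {m} inv)

  final-invariant : ∀ {k m} → Invariant 0 k m → k ℕ.+ suc m ≡ n
  final-invariant {k} {m} inv = ≡.trans (ℕₚ.+-suc k m) (≡.trans (ℕₚ.+-comm 1 (k ℕ.+ m)) inv)

  -- While some vertex is unexplored the two boundary edges are different, so no edge is counted
  -- twice.
  known-≤-total : ∀ δ {u k m} → Invariant (suc u) k m → a δ k + b δ k + d δ m ≤ total
  known-≤-total δ {u} {k} {m} inv = ≤-trans (≤-reflexive (+-congʳ (sym (a-suc δ k))))
    (arcs-≤-total δ {suc k} {suc m} (≡.subst (suc k ℕ.+ suc m ℕ.≤_) (direct-invariant {u} {k} {m} inv)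
      (≡.subst (ℕ._≤ suc (k ℕ.+ m ℕ.+ suc u)) (≡.sym (≡.cong suc (ℕₚ.+-suc k m)))
        (s≤s (≡.subst (suc (k ℕ.+ m) ℕ.≤_) (≡.sym (ℕₚ.+-suc (k ℕ.+ m) u)) (s≤s (ℕₚ.m≤m+n (k ℕ.+ m) u)))))))

  step-≤ : ∀ u δ k m {X Y Z} →
    (b δ k ≤ (α + 1#) * a δ k + d δ m → b δ k + expected u δ (suc k) m ≤ Z) →
    (¬ (b δ k ≤ (α + 1#) * a δ k + d δ m) → 0# ≤ b δ k - d δ m - a δ k →
      b δ k + expected u δ (suc k) m ≤ X × a δ k + d δ m + expected u (opposite δ) (suc m) k ≤ Y ×
      0# ≤ α * a δ k * (Z - X) + (b δ k - d δ m - a δ k - α * a δ k) * (Z - Y)) →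
    expected (suc u) δ k m ≤ Z
  step-≤ u δ k m direct random =
    coin-≤ (*-nonNeg 0≤α (arc-nonNeg δ s k))
      (λ cheap → ≤-trans (≤-reflexive x≈) (direct cheap))
      (λ dear 0≤t → let x≤ , y≤ , 0≤Δ = random dear 0≤t in
        ≤-trans (≤-reflexive x≈) x≤ , ≤-trans (≤-reflexive y≈) y≤ , 0≤Δ)
    where
    x≈ = 𝔼-pay (b δ k) (explore α tie Γ s u δ (suc k) m)
    y≈ = 𝔼-pay (a δ k + d δ m) (explore α tie Γ s u (opposite δ) (suc m) k)

  -- If the explored part together with the backtracking edge makes up half of
  -- the cycle, every remaining move is forced to be direct.
  expected-direct : ∀ u δ k m → Invariant u k m → total ≤ (a δ k + d δ m) + (a δ k + d δ m) →
    expected u δ k m ≤ total - a δ k ×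
    expected u δ k m ≤ (total - d δ m) + (total - d δ m) - a δ k
  -- The backtracking edge now closes the cycle, so a + d is the total. Returning across it gives
  -- the first bound, returning over the explored path the second.
  expected-direct zero δ k m inv _ =
    ≤-trans (x⊓y≤y (a δ k) (arc (opposite δ) s (n ℕ.∸ k))) (≤-reflexive (trans (reflexive (≡.cong (arc (opposite δ) s) n∸k))
      (trans (solve 2 (λ x y → y := x :+ y :- x) refl (a δ k) (d δ m)) (+-congʳ a+d≈total)))) ,
    ≤-trans (x⊓y≤x (a δ k) (arc (opposite δ) s (n ℕ.∸ k))) (≤-reflexive
      (trans (solve 2 (λ x y → x := x :+ y :- y :+ (x :+ y :- y) :- x) refl (a δ k) (d δ m))
        (+-congʳ (+-cong (+-congʳ a+d≈total) (+-congʳ a+d≈total)))))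
    where
    n∸k : n ℕ.∸ k ≡ suc m
    n∸k = ≡.trans (≡.cong (ℕ._∸ k) (≡.sym (final-invariant {k} {m} inv))) (ℕₚ.m+n∸m≡n k (suc m))
    a+d≈total : a δ k + d δ m ≈ total
    a+d≈total = trans (arc-complement δ s k (suc m) (final-invariant {k} {m} inv)) (arc-n δ s)
  -- The random case is contradictory, so `0#` is an arbitrary choice for X and Y.
  expected-direct (suc u) δ k m inv total≤ =
    step-≤ u δ k m {0#} {0#} (λ _ → extend (proj₁ IH)) (λ dear _ → contradiction cheap dear) ,
    step-≤ u δ k m {0#} {0#} (λ _ → extend (proj₂ IH)) (λ dear _ → contradiction cheap dear)
    where
    extend : ∀ {e r} → e ≤ r - a δ (suc k) → b δ k + e ≤ r - a δ k
    extend {e} {r} e≤ = by-difference (x≤y⇒0≤y-x e≤) (trans (+-congʳ (+-congˡ (-‿cong (a-suc δ k))))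
      (solve 4 (λ e r a b → r :- (a :+ b) :- e := r :- a :- (b :+ e)) refl e r (a δ k) (b δ k)))
    -- The direct edge lies in the other part of the cycle: b ≤ total - (a + d) ≤ a + d.
    cheap : b δ k ≤ (α + 1#) * a δ k + d δ m
    cheap = by-difference (+-nonNeg (+-nonNeg (x≤y⇒0≤y-x (known-≤-total δ {u} {k} {m} inv)) (x≤y⇒0≤y-x total≤))
                            (*-nonNeg 0≤α (arc-nonNeg δ s k)))
      (solve 5 (λ L α a b d → L :- (a :+ b :+ d) :+ (a :+ d :+ (a :+ d) :- L) :+ α :* a :=
        (α :+ con (+ 1)) :* a :+ d :- b) refl total α (a δ k) (b δ k) (d δ m))
    IH = expected-direct u δ (suc k) m (direct-invariant {u} {k} {m} inv) (≤-trans total≤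
      (by-difference (+-nonNeg (weight-nonNeg δ (steps δ k s)) (weight-nonNeg δ (steps δ k s)))
        (trans (solve 3 (λ a b d → b :+ b := a :+ b :+ d :+ (a :+ b :+ d) :- (a :+ d :+ (a :+ d))) refl (a δ k) (b δ k) (d δ m))
          (+-congʳ (+-cong (+-congʳ (sym (a-suc δ k))) (+-congʳ (sym (a-suc δ k))))))))

  Φ-cong : ∀ {r a a′ d d′} → a ≈ a′ → d ≈ d′ → Φ r a d ≈ Φ r a′ d′
  Φ-cong a≈a′ d≈d′ = +-cong (+-cong (+-congˡ (-‿cong a≈a′)) (*-congˡ (+-congˡ (-‿cong d≈d′)))) (-‿cong (*-congˡ a≈a′))

  +-monoʳ-≤ : ∀ z {x y} → x ≤ y → z + x ≤ z + y
  +-monoʳ-≤ z {x} {y} x≤y = by-difference (x≤y⇒0≤y-x x≤y) (solve 3 (λ x y z → y :- x := z :+ y :- (z :+ x)) refl x y z)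

  0≤r-d-a : ∀ {r a d} → a + d ≤ r → 0# ≤ r - d - a
  0≤r-d-a {r} {a} {d} a+d≤r = 0≤-resp (solve 3 (λ r a d → r :- (a :+ d) := r :- d :- a) refl r a d) (x≤y⇒0≤y-x a+d≤r)

  Φ-step : ∀ {r} u δ k m →
    expected u δ (suc k) m ≤ Φ r (a δ (suc k)) (d δ m) →
    expected u (opposite δ) (suc m) k ≤ Φ r (a (opposite δ) (suc m)) (d (opposite δ) k) →
    expected (suc u) δ k m ≤ Φ r (a δ k) (d δ m)
  Φ-step {r} u δ k m direct≤ backtrack≤ = step-≤ u δ k m
    (λ _ → ≤-trans x≤X (Φ-direct (weight-nonNeg δ (steps δ k s))))
    (λ _ 0≤t → x≤X , y≤Y , Φ-random (arc-nonNeg (opposite δ) s (suc m)) 0≤t)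
    where
    x≤X : b δ k + expected u δ (suc k) m ≤ b δ k + Φ r (a δ k + b δ k) (d δ m)
    x≤X = +-monoʳ-≤ (b δ k) (≤-trans direct≤ (≤-reflexive (Φ-cong (a-suc δ k) refl)))
    y≤Y : a δ k + d δ m + expected u (opposite δ) (suc m) k ≤ a δ k + d δ m + Φ r (d δ m) (a δ k + b δ k)
    y≤Y = +-monoʳ-≤ (a δ k + d δ m) (≤-trans backtrack≤ (≤-reflexive (Φ-cong refl (d-opposite δ k))))

  -- Cycles without a heavy edge.

  module Balanced (r : Carrier) (r+r≈total : r + r ≈ total) (w≤r : ∀ v → w v ≤ r) where

    b≤r : ∀ δ k → b δ k ≤ r
    b≤r cw  k = w≤r (steps cw k s)
    b≤r ccw k = w≤r (step ccw (steps ccw k s))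

    double : ∀ {x} → r ≤ x → total ≤ x + x
    double r≤x = by-difference (+-nonNeg (x≤y⇒0≤y-x r≤x) (x≤y⇒0≤y-x r≤x))
      (trans (solve 2 (λ r x → x :- r :+ (x :- r) := x :+ x :- (r :+ r)) refl r _) (+-congˡ (-‿cong r+r≈total)))

    expected-≤ : ∀ u δ k m → Invariant u k m → a δ k + d δ m ≤ r → expected u δ k m ≤ Φ r (a δ k) (d δ m)
    -- Here a + d is the whole cycle, so a + d ≤ r forces total weight 0; the forced-move bound
    -- covers this degenerate case.
    expected-≤ zero δ k m inv a+d≤r = ≤-trans
      (proj₁ (expected-direct zero δ k m inv (by-difference 0≤a+d
        (trans (solve 1 (λ x → x := x :+ x :- x) refl _) (+-congˡ (-‿cong a+d≈total))))))
      (≤-trans (≤-reflexive (+-congʳ (sym r+r≈total)))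
        (Φ-lower (arc-nonNeg δ s k) (0≤r-d-a a+d≤r)))
      where
      0≤a+d = +-nonNeg (arc-nonNeg δ s k) (arc-nonNeg (opposite δ) s (suc m))
      a+d≈total : a δ k + d δ m ≈ total
      a+d≈total = trans (arc-complement δ s k (suc m) (final-invariant {k} {m} inv)) (arc-n δ s)
    -- Either move leads to a state in which a + b + d plays the role of a + d. If it is at most r,
    -- induction applies; otherwise half of the cycle is known and all later moves are direct.
    expected-≤ (suc u) δ k m inv a+d≤r with ≤-total (a δ k + b δ k + d δ m) r
    ... | inj₁ a+b+d≤r = Φ-step u δ k m
      (expected-≤ u δ (suc k) m (direct-invariant {u} {k} {m} inv) (≤-trans (≤-reflexive (+-congʳ (a-suc δ k))) a+b+d≤r))
      (expected-≤ u (opposite δ) (suc m) k (backtrack-invariant {u} {k} {m} inv)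
        (≤-trans (≤-reflexive (trans (+-congˡ (d-opposite δ k)) (+-comm _ _))) a+b+d≤r))
    ... | inj₂ r≤a+b+d = step-≤ u δ k m
      (λ _ → ≤-trans x≤X (Φ-lower (arc-nonNeg δ s k) (0≤r-d-a a+d≤r)))
      (λ _ 0≤t → x≤X , y≤Y , Φ-last-random (arc-nonNeg δ s k) (0≤r-d-a a+d≤r) (b≤r δ k) 0≤t)
      where
      x≤X : b δ k + expected u δ (suc k) m ≤ r + r - a δ k
      x≤X = ≤-trans (+-monoʳ-≤ (b δ k) (proj₁ (expected-direct u δ (suc k) m (direct-invariant {u} {k} {m} inv)
          (double (≤-trans r≤a+b+d (≤-reflexive (+-congʳ (sym (a-suc δ k)))))))))
        (≤-reflexive (trans (+-congˡ (+-cong (sym r+r≈total) (-‿cong (a-suc δ k))))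
          (solve 3 (λ r a b → b :+ (r :+ r :- (a :+ b)) := r :+ r :- a) refl r (a δ k) (b δ k))))
      y≤Y : a δ k + d δ m + expected u (opposite δ) (suc m) k ≤ r + r + a δ k
      y≤Y = ≤-trans (+-monoʳ-≤ (a δ k + d δ m) (proj₁ (expected-direct u (opposite δ) (suc m) k (backtrack-invariant {u} {k} {m} inv)
          (double (≤-trans r≤a+b+d (≤-reflexive (trans (+-comm _ _) (+-congˡ (sym (d-opposite δ k))))))))))
        (≤-reflexive (trans (+-congˡ (+-congʳ (sym r+r≈total)))
          (solve 3 (λ r a d → a :+ d :+ (r :+ r :- d) := r :+ r :+ a) refl r (a δ k) (d δ m))))

  -- Cycles with a heavy edge.

  module Heavy (i : Vertex) (heavy : total ≤ w i + w i) where

    r : Carrier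
    r = total - w i

    -- j and j′ count the edges between s and the heavy edge on the two sides. Then k ≤ j allows it
    -- to be the direct edge, while m < j′ excludes it as the backtracking edge.
    expected-≤ : ∀ u δ k m j j′ → Invariant u k m → suc (j ℕ.+ j′) ≡ n → edge δ s j ≡ w i →
      k ℕ.≤ j → m ℕ.< j′ → expected u δ k m ≤ Φ r (a δ k) (d δ m)
    expected-≤ zero δ k m j j′ inv j+j′+1≡n _ k≤j m<j′ = contradiction
      (≡.trans (final-invariant {k} {m} inv) (≡.sym j+j′+1≡n)) (ℕₚ.<⇒≢ (s≤s (ℕₚ.+-mono-≤ k≤j m<j′)))
    expected-≤ (suc u) δ k m j j′ inv j+j′+1≡n e≡w k≤j m<j′ with k ℕₚ.≟ j
    -- The direct edge is not the heavy one, so k < j, which keeps the hypotheses true after either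
    -- move. Backtracking exchanges j and j′.
    ... | no k≢j = Φ-step u δ k m
      (expected-≤ u δ (suc k) m j j′ (direct-invariant {u} {k} {m} inv) j+j′+1≡n e≡w k<j m<j′)
      (expected-≤ u (opposite δ) (suc m) k j′ j (backtrack-invariant {u} {k} {m} inv)
        (≡.trans (≡.cong suc (ℕₚ.+-comm j′ j)) j+j′+1≡n)
        (≡.trans (edge-opposite δ s {j} {j′} j+j′+1≡n) e≡w) m<j′ k<j)
      where k<j = ℕₚ.≤∧≢⇒< k≤j k≢j
    -- The direct edge is the heavy one. After this move it is either explored or the backtracking
    -- edge; in both cases the new a + d is at least half of the total, and no backtracking follows.
    ... | yes ≡.refl = step-≤ u δ k m
      (λ cheap → ≤-trans x≤X (Φ-heavy-direct (arc-nonNeg δ s k) 0≤r-d-a′ cheap))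
      (λ _ 0≤t → x≤X , y≤Y , Φ-heavy-random (arc-nonNeg δ s k) 0≤r-d-a′ 0≤t)
      where
      b≈w : b δ k ≈ w i
      b≈w = reflexive e≡w
      0≤r-d-a′ : 0# ≤ r - d δ m - a δ k
      0≤r-d-a′ = 0≤-resp (trans (+-congˡ (-‿cong (+-congʳ (+-congˡ b≈w))))
          (solve 4 (λ L a b d → L :- (a :+ b :+ d) := L :- b :- d :- a) refl total (a δ k) (w i) (d δ m)))
        (x≤y⇒0≤y-x (known-≤-total δ {u} {k} {m} inv))
      total≤ : ∀ {x y} → 0# ≤ x → 0# ≤ y → ∀ {z} → z ≈ x + b δ k + y → total ≤ z + z
      total≤ {x} {y} 0≤x 0≤y {z} z≈ = by-difference
        (+-nonNeg (x≤y⇒0≤y-x heavy) (+-nonNeg (+-nonNeg 0≤x 0≤y) (+-nonNeg 0≤x 0≤y)))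
        (trans (solve 4 (λ L w x y → w :+ w :- L :+ (x :+ y :+ (x :+ y)) := x :+ w :+ y :+ (x :+ w :+ y) :- L) refl total (w i) x y)
          (+-congʳ (+-cong eq eq)))
        where
        eq : x + w i + y ≈ z
        eq = sym (trans z≈ (+-congʳ (+-congˡ b≈w)))
      0≤a = arc-nonNeg δ s k
      0≤d = arc-nonNeg (opposite δ) s (suc m)
      x≤X : b δ k + expected u δ (suc k) m ≤ r + b δ k - a δ k
      x≤X = ≤-trans (+-monoʳ-≤ (b δ k) (proj₁ (expected-direct u δ (suc k) m (direct-invariant {u} {k} {m} inv)
          (total≤ 0≤a 0≤d (+-congʳ (a-suc δ k))))))
        (≤-reflexive (trans (+-congˡ (+-congˡ (-‿cong (a-suc δ k))))
          (trans (solve 3 (λ L a b → b :+ (L :- (a :+ b)) := L :- b :+ b :- a) refl total (a δ k) (b δ k))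
            (+-congʳ (+-congʳ (+-congˡ (-‿cong b≈w)))))))
      y≤Y : a δ k + d δ m + expected u (opposite δ) (suc m) k ≤ r + r - a δ k
      y≤Y = ≤-trans (+-monoʳ-≤ (a δ k + d δ m) (proj₂ (expected-direct u (opposite δ) (suc m) k (backtrack-invariant {u} {k} {m} inv)
          (total≤ 0≤a 0≤d (trans (+-congˡ (d-opposite δ k)) (+-comm _ _))))))
        (≤-reflexive (trans (+-congˡ (+-congʳ (+-cong (+-congˡ (-‿cong a+w)) (+-congˡ (-‿cong a+w)))))
          (solve 4 (λ L a w d → a :+ d :+ (L :- (a :+ w) :+ (L :- (a :+ w)) :- d) := L :- w :+ (L :- w) :- a) refl total (a δ k) (w i) (d δ m))))
        where
        a+w : d (opposite δ) k ≈ a δ k + w i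
        a+w = trans (d-opposite δ k) (+-congˡ b≈w)

  -- The first step and the total cost.

  first : Direction
  first = firstDirection α tie Γ s

  first-lighter : weight first s ≤ weight (opposite first) s
  first-lighter with weight cw s ≤? weight ccw s | weight ccw s ≤? weight cw s
  ... | no cw≰ccw | _ with ≤-total (weight cw s) (weight ccw s)
  ...   | inj₁ cw≤ccw = contradiction cw≤ccw cw≰ccw
  ...   | inj₂ ccw≤cw = ccw≤cw
  first-lighter | yes cw≤ccw | no _ = cw≤ccw
  first-lighter | yes cw≤ccw | yes ccw≤cw with tie Γ s
  ... | cw  = cw≤ccw
  ... | ccw = ccw≤cw

  arc-1 : ∀ δ → arc δ s 1 ≈ weight δ s
  arc-1 δ = +-identityʳ (weight δ s)

  κ : Carrier
  κ = α + μ

  cost : Carrier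
  cost = 𝔼 (RandHeavyTest α tie Γ s)

  module _ {x : Carrier} (x≤ : expected (suc extra) first 1 0 ≤ x) where
    cost-≤ : cost ≤ a first 1 + x
    cost-≤ = ≤-trans (≤-reflexive (trans (𝔼-pay _ (explore α tie Γ s (suc extra) first 1 0))
      (+-congʳ (sym (arc-1 first))))) (+-monoʳ-≤ (a first 1) x≤)

  x+κr-≥ : ∀ {r x} → 0# ≤ r → x ≤ x + κ * r
  x+κr-≥ {r} {x} 0≤r = by-difference (*-nonNeg 0≤κ 0≤r) (solve 2 (λ x y → y := x :+ y :- x) refl x (κ * r))

  cost-balanced : ∀ {r} → r + r ≈ total → (∀ v → w v ≤ r) → cost ≤ r + r + κ * r
  cost-balanced {r} r+r≈total w≤r with ≤-total (a first 1 + d first 0) r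
  ... | inj₁ a+d≤r = ≤-trans
    (cost-≤ (Balanced.expected-≤ r r+r≈total w≤r (suc extra) first 1 0 ≡.refl a+d≤r))
    (Φ-upper (arc-nonNeg first s 1) (arc-nonNeg (opposite first) s 1))
  -- The two edges at s already make up half of the cycle, so going once round is forced.
  ... | inj₂ r≤a+d = ≤-trans
    (cost-≤ (proj₁ (expected-direct (suc extra) first 1 0 ≡.refl (Balanced.double r r+r≈total w≤r r≤a+d))))
    (≤-trans (≤-reflexive (trans (solve 2 (λ a L → a :+ (L :- a) := L) refl (a first 1) total) (sym r+r≈total)))
      (x+κr-≥ (≤-trans (w-nonNeg s) (w≤r s))))

  module _ {i : Vertex} (heavy : ¬ (w i + w i ≤ total)) where
    private
      total≤2w : total ≤ w i + w i
      total≤2w with ≤-total total (w i + w i)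
      ... | inj₁ ≤2w = ≤2w
      ... | inj₂ 2w≤ = contradiction 2w≤ heavy

      a+d≤total : a first 1 + d first 0 ≤ total
      a+d≤total = arcs-≤-total first {1} {1} (s≤s (s≤s z≤n))

      located : ∀ δ → ∃[ j ] ∃[ j′ ] (suc (j ℕ.+ j′) ≡ n × edge δ s j ≡ w i)
      located cw = position s i , _ , ℕₚ.m+[n∸m]≡n (position<n s i) , ≡.cong w (steps-position s i)
      located ccw with located cw
      ... | j , j′ , j+j′+1≡n , e≡w = j′ , j ,
        ≡.trans (≡.cong suc (ℕₚ.+-comm j′ j)) j+j′+1≡n ,
        ≡.trans (edge-opposite cw s {j} {j′} j+j′+1≡n) e≡w

      open Heavy i total≤2w

      from-position : ∀ j j′ → suc (j ℕ.+ j′) ≡ n → edge first s j ≡ w i → cost ≤ r + r + κ * r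
      -- The first edge is the lighter one at s; were it heavy, the two edges at s would weigh more
      -- than the whole cycle.
      from-position zero j′ _ e≡w = contradiction (≤-trans
        (by-difference (x≤y⇒0≤y-x first-lighter)
          (trans (solve 2 (λ x y → y :- x := x :+ y :- (x :+ x)) refl (weight first s) (weight (opposite first) s))
            (+-cong (+-cong (sym (arc-1 first)) (sym (arc-1 (opposite first))))
              (-‿cong (+-cong (reflexive e≡w) (reflexive e≡w))))))
        a+d≤total) heavy
      -- The heavy edge is the other edge at s, hence the backtracking edge from the start. The
      -- second bound of `expected-direct` then gives cost at most 2r.
      from-position j@(suc _) zero j+1≡n e≡w = ≤-trans
        (cost-≤ (proj₂ (expected-direct (suc extra) first 1 0 ≡.refl
          (by-difference (+-nonNeg (x≤y⇒0≤y-x total≤2w) (+-nonNeg 0≤a 0≤a))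
            (trans (solve 3 (λ a h L → h :+ h :- L :+ (a :+ a) := a :+ h :+ (a :+ h) :- L) refl (a first 1) (w i) total)
              (+-congʳ (+-cong (+-congˡ w≈d) (+-congˡ w≈d))))))))
        (≤-trans (≤-reflexive (trans
            (solve 3 (λ a d L → a :+ (L :- d :+ (L :- d) :- a) := L :- d :+ (L :- d)) refl (a first 1) (d first 0) total)
            (+-cong (+-congˡ (-‿cong (sym w≈d))) (+-congˡ (-‿cong (sym w≈d))))))
          (x+κr-≥ (0≤-resp (trans (solve 3 (λ a d L → L :- (a :+ d) :+ a := L :- d) refl (a first 1) (d first 0) total)
              (+-congˡ (-‿cong (sym w≈d))))
            (+-nonNeg (x≤y⇒0≤y-x a+d≤total) 0≤a))))
        where
        0≤a = arc-nonNeg first s 1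
        w≈d : w i ≈ d first 0
        w≈d = sym (trans (arc-1 (opposite first)) (reflexive (≡.trans (edge-opposite first s {j} {0} j+1≡n) e≡w)))
      from-position j@(suc _) j′@(suc _) eq e≡w = ≤-trans
        (cost-≤ (expected-≤ (suc extra) first 1 0 j j′ ≡.refl eq e≡w (s≤s z≤n) (s≤s z≤n)))
        (Φ-upper (arc-nonNeg first s 1) (arc-nonNeg (opposite first) s 1))

    cost-heavy : cost ≤ (total - w i) + (total - w i) + κ * (total - w i)
    cost-heavy with located first
    ... | j , j′ , j+j′+1≡n , e≡w = from-position j j′ j+j′+1≡n e≡w

-- Comparison with the optimum.

module Competitiveness {c ℓ₁ ℓ₂} {F : OrderedField c ℓ₁ ℓ₂}
  (R : SquareRootOfTwo F) (tie : Exploration.TieBreaking F) where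
  open OrderedField F
  open OrderedFieldProperties F
  open Exploration F
  open Constants R

  module _ (Γ : WeightedCycle) (s : WeightedCycle.Vertex Γ) where
    open WeightedCycle Γ
    open CycleProperties F Γ
    open Analysis parameters tie Γ s

    half : Carrier
    half = α * total

    half+half≈total : half + half ≈ total
    half+half≈total = begin
      α * total + α * total     ≈⟨ solve 2 (λ α L → α :* L :+ α :* L := con (+ 2) :* α :* L) refl α total ⟩
      ⟦ + 2 ⟧ * α * total       ≈⟨ *-congʳ (trans (*-congʳ (sym (⟦+⟧ 2))) (fromℕ-suc-*-/ 1 1#)) ⟩
      1# * total                ≈⟨ *-identityˡ total ⟩
      total                     ∎
      where open SetoidReasoning setoid

    -- Since κ = 2γ, the bound 2r + κ r equals (1 + γ) 2r.
    r+r≤tour⇒cost-≤ : ∀ {r o} → cost ≤ r + r + κ * r → r + r ≤ o → cost ≤ (1# + γ) * o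
    r+r≤tour⇒cost-≤ {r} {o} cost≤ r+r≤o = ≤-trans cost≤ (by-difference
      (*-nonNeg (+-nonNeg 0≤1 0≤γ) (x≤y⇒0≤y-x r+r≤o))
      (solve 4 (λ α γ r o → (con (+ 1) :+ γ) :* (o :- (r :+ r)) := (con (+ 1) :+ γ) :* o :- (r :+ r :+ (α :+ (γ :+ γ :- α)) :* r)) refl α γ r o))
      where
      0≤γ : 0# ≤ γ
      0≤γ = *-cancelˡ-nonNeg (⟦+suc⟧≰0 1) (0≤-resp (solve 2 (λ α γ → α :+ (γ :+ γ :- α) := con (+ 2) :* γ) refl α γ) (+-nonNeg 0≤α 0≤μ))

    cost-≤-tour : ∀ t → cost ≤ (1# + γ) * tourLength t
    cost-≤-tour t with all? (λ v → w v + w v ≤? total)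
    ... | yes balanced = r+r≤tour⇒cost-≤ {half} (cost-balanced half+half≈total w≤half)
      (≤-trans (≤-reflexive half+half≈total) total≤tour)
      where
      w≤half : ∀ v → w v ≤ half
      w≤half v = 0≤y-x⇒x≤y (*-cancelˡ-nonNeg (⟦+suc⟧≰0 1) (0≤-resp
        (trans (+-congʳ (sym half+half≈total)) (solve 2 (λ h x → h :+ h :- (x :+ x) := con (+ 2) :* (h :- x)) refl half (w v)))
        (x≤y⇒0≤y-x (balanced v))))
      total≤tour : total ≤ tourLength t
      total≤tour with tour-≥ t
      ... | inj₁ total≤ = total≤
      -- Doubling all edges but one saves nothing when that edge is at most half of the total.
      ... | inj₂ (i , ≤tour) = ≤-trans (by-difference (x≤y⇒0≤y-x (balanced i))
        (solve 2 (λ L x → L :- (x :+ x) := L :- x :+ (L :- x) :- L) refl total (w i))) ≤tour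
    ... | no ¬balanced with ¬∀⟶∃¬ n _ (λ v → w v + w v ≤? total) ¬balanced
    ...   | i , heavy = r+r≤tour⇒cost-≤ (cost-heavy heavy) light≤tour
      where
      total≤2w : total ≤ w i + w i
      total≤2w with ≤-total total (w i + w i)
      ... | inj₁ ≤2w = ≤2w
      ... | inj₂ 2w≤ = contradiction 2w≤ heavy
      light≤tour : (total - w i) + (total - w i) ≤ tourLength t
      light≤tour with tour-≥ t
      ... | inj₁ total≤ = ≤-trans (by-difference (x≤y⇒0≤y-x total≤2w)
        (solve 2 (λ L x → x :+ x :- L := L :- (L :- x :+ (L :- x))) refl total (w i))) total≤
      ... | inj₂ (j , ≤tour) with i ≟ᶠ j
      ...   | yes ≡.refl = ≤tour
      -- Leaving out another edge j is no better: w j ≤ total - w i ≤ w i.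
      ...   | no i≢j = ≤-trans (by-difference (+-nonNeg 0≤slack 0≤slack)
        (solve 3 (λ L x y → x :+ x :- L :+ (L :- (x :+ y)) :+ (x :+ x :- L :+ (L :- (x :+ y))) :=
          L :- y :+ (L :- y) :- (L :- x :+ (L :- x))) refl total (w i) (w j))) ≤tour
        where 0≤slack = +-nonNeg (x≤y⇒0≤y-x total≤2w) (x≤y⇒0≤y-x (edges-≤-total i≢j))

theorem2 : ∀ {c ℓ₁ ℓ₂} (F : OrderedField c ℓ₁ ℓ₂) →
    let open OrderedField F
        open Exploration F
    in (tie : TieBreaking) (√2 : Carrier) → 0# ≤ √2 → √2 * √2 ≈ fromℕ 2 →
       let Alg   = RandHeavyTest (1# / fromℕ 2) tie
           bound = 1# + (fromℕ 3 - √2) ^ 2 / fromℕ 8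
       in Competitive Alg bound ×
          (∀ ρ → IsCompetitiveRatio Alg ρ → ρ ≤ bound)
theorem2 F tie √2 0≤√2 √2*√2≈2 = competitive , λ ρ (ρ≤ , _) → ρ≤ bound competitive
  where
  open OrderedField F
  open OrderedFieldProperties F
  open Exploration F
  root : SquareRootOfTwo F
  root = record { √2 = √2 ; 0≤√2 = 0≤√2 ; √2*√2≈2 = √2*√2≈2 }
  open Competitiveness root tie
  bound : Carrier
  bound = 1# + (fromℕ 3 - √2) ^ 2 / fromℕ 8
  competitive : Competitive (RandHeavyTest (1# / fromℕ 2) tie) bound
  competitive Γ s o ((t , t≈o) , _) = ≤-trans (cost-≤-tour Γ s t) (≤-reflexive (*-congˡ t≈o))
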